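{- Let $G$ be an extension of an M-closed 2-edge-coloured graph. Then $G$ is supereulerian if and only if $G$ is trail-colour-connected and has an eulerian factor.
   Context: Graphs are finite, undirected, without loops, and may contain parallel edges. A 2-edge-coloured graph is a graph $G=(V,E)$ with a colouring $\phi:E\to\{1,2\}$. A trail is a walk that uses no edge more than once. A walk or trail is alternating if consecutive edges have different colours; for a closed alternating walk or trail the first and last edges must also have different colours (so it has at least two edges). A closed trail is spanning if it visits every vertex. A 2-edge-coloured graph is M-closed if, whenever some vertex $u$ is joined to two distinct vertices $x,z$ by edges of the same colour, $xz$ is an edge of the graph (of any colour). An extension of a 2-edge-coloured graph $G_0$ on $n>1$ vertices $v_1,\dots,v_n$ is any graph obtained by replacing each $v_i$ by an independent set $\{v_{i,1},\dots,v_{i,p_i}\}$ with $p_i\ge 1$ and, for every edge $v_iv_j$ of $G_0$ of colour $c$, including an edge of colour $c$ between $v_{i,q}$ and $v_{j,r}$ for all $q\in\{1,\dots,p_i\}$, $r\in\{1,\dots,p_j\}$ (there are no other edges). A 2-edge-coloured graph $G$ is supereulerian if it contains a spanning closed alternating trail. An eulerian factor of $G$ is a collection of vertex-disjoint induced subgraphs $G_1,\dots,G_k$ ($k\ge 1$) of $G$ whose vertex sets cover $V(G)$ and each of which is supereulerian. $G$ is trail-colour-connected if for every pair of distinct vertices $u,v$ it contains two alternating $(u,v)$-trails $T_1,T_2$ whose union is a closed alternating walk (i.e. $T_1$ and $T_2$ have first edges of different colours at $u$ and last edges of different colours at $v$). -}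

module Defs where

open import Data.Nat using (ℕ; _≤_; _<_)
open import Data.Fin using (Fin)
open import Data.List using (List; []; _∷_; head; last)
open import Data.List.Membership.Propositional using (_∈_)
open import Data.List.Relation.Unary.Linked using (Linked)
open import Data.List.Relation.Unary.Unique.Propositional using (Unique)
open import Data.Maybe using (just)
open import Data.Product using (Σ-syntax; ∃-syntax; _×_; _,_)
open import Data.Sum using (_⊎_)
open import Function.Bundles using (_↔_; module Inverse)
open import Function.Definitions using (Injective)
open import Relation.Binary.PropositionalEquality using (_≡_; _≢_)

-- Graphs are undirected: `src` and `tgt` list the two ends of an edge in an
-- arbitrary order, which the definitions below forget by going through `Joins`.
-- Distinct edges may have the same ends, also when they have the same colour.
record Graph : Set where
  field
    order    : ℕ
    size     : ℕ
    src tgt  : Fin size → Fin order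
    loopless : ∀ e → src e ≢ tgt e
    colour   : Fin size → Fin 2

  V E : Set
  V = Fin order
  E = Fin size

  Joins : E → V → V → Set
  Joins e u v = (src e ≡ u × tgt e ≡ v) ⊎ (src e ≡ v × tgt e ≡ u)

  data Walk : V → V → Set where
    nil  : ∀ {u} → Walk u u
    step : ∀ {u v w} (e : E) → Joins e u v → Walk v w → Walk u w

  edges : ∀ {u v} → Walk u v → List E
  edges nil          = []
  edges (step e _ w) = e ∷ edges w

  vertices : ∀ {u v} → Walk u v → List V
  vertices {u} nil          = u ∷ []
  vertices {u} (step _ _ w) = u ∷ vertices w

  IsTrail : ∀ {u v} → Walk u v → Set
  IsTrail w = Unique (edges w)

  Alternating : ∀ {u v} → Walk u v → Set
  Alternating w = Linked (λ e f → colour e ≢ colour f) (edges w)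

  FirstEdge LastEdge : ∀ {u v} → Walk u v → E → Set
  FirstEdge w e = head (edges w) ≡ just e
  LastEdge  w e = last (edges w) ≡ just e

  -- The condition on the first and last edges excludes the walk `nil` and
  -- walks with a single edge.
  ClosedAlternating : ∀ {u} → Walk u u → Set
  ClosedAlternating w =
    Alternating w ×
    (∃[ e ] ∃[ f ] FirstEdge w e × LastEdge w f × colour e ≢ colour f)

  Spanning : ∀ {u v} → Walk u v → Set
  Spanning w = ∀ x → x ∈ vertices w

  Supereulerian : Set
  Supereulerian =
    ∃[ u ] Σ[ w ∈ Walk u u ] IsTrail w × ClosedAlternating w × Spanning w

  MClosed : Set
  MClosed = ∀ {u x z e f} → Joins e u x → Joins f u z →
            colour e ≡ colour f → x ≢ z → ∃[ g ] Joins g x z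

  TrailColourConnected : Set
  TrailColourConnected = ∀ {u v} → u ≢ v →
    Σ[ T₁ ∈ Walk u v ] Σ[ T₂ ∈ Walk u v ]
      IsTrail T₁ × Alternating T₁ ×
      IsTrail T₂ × Alternating T₂ ×
      (∃[ e ] ∃[ f ] FirstEdge T₁ e × FirstEdge T₂ f × colour e ≢ colour f) ×
      (∃[ e ] ∃[ f ] LastEdge T₁ e × LastEdge T₂ f × colour e ≢ colour f)

open Graph

-- H is, up to the names of its vertices and edges, the subgraph of G induced
-- by the image of `vertex`.
record InducedSubgraph (G H : Graph) : Set where
  field
    vertex           : V H → V G
    edge             : E H → E G
    vertex-injective : Injective _≡_ _≡_ vertex
    edge-injective   : Injective _≡_ _≡_ edge
    edge-joins       : ∀ e → Joins G (edge e) (vertex (src H e)) (vertex (tgt H e))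
    edge-colour      : ∀ e → colour G (edge e) ≡ colour H e
    edge-full        : ∀ {e u v} → Joins G e (vertex u) (vertex v) →
                       ∃[ e′ ] edge e′ ≡ e

open InducedSubgraph

record EulerianFactor (G : Graph) : Set where
  field
    k             : ℕ
    k≥1           : 1 ≤ k
    part          : Fin k → Graph
    induced       : ∀ i → InducedSubgraph G (part i)
    disjoint      : ∀ {i j u v} → vertex (induced i) u ≡ vertex (induced j) v → i ≡ j
    covering      : ∀ x → ∃[ i ] ∃[ u ] vertex (induced i) u ≡ x
    supereulerian : ∀ i → Supereulerian (part i)

-- `copies` names the vertices of G as v_{i,q}.  By `links`, every edge of G₀
-- with ends v_i and v_j gives exactly one edge of G between v_{i,q} and v_{j,r}
-- for each q and r, and G has no other edges; in particular the copies of one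
-- vertex are independent since G₀ has no loops.
record Extension (G₀ G : Graph) : Set where
  field
    order>1     : 1 < order G₀
    p           : V G₀ → ℕ
    p≥1         : ∀ i → 1 ≤ p i
    copies      : (Σ[ i ∈ V G₀ ] Fin (p i)) ↔ V G
    links       : (Σ[ e ∈ E G₀ ] (Fin (p (src G₀ e)) × Fin (p (tgt G₀ e)))) ↔ E G
    link-joins  : ∀ e q r →
                  Joins G (Inverse.to links (e , q , r))
                          (Inverse.to copies (src G₀ e , q))
                          (Inverse.to copies (tgt G₀ e , r))
    link-colour : ∀ e q r → colour G (Inverse.to links (e , q , r)) ≡ colour G₀ e

{-# OPTIONS --safe #-}
-- By Kotzig's theorem G is supereulerian iff it has a connected spanning set F
-- of edges that is balanced, i.e. has as many edges of either colour at each
-- vertex.  An eulerian factor is a balanced F without isolated vertices; take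
-- one that no exchange of edges can make more connected.  If an edge joins two
-- components C and D of F, then M-closedness and the absence of local
-- improvements show that one of them, say D, dominates the other: D splits into
-- two classes, the vertices of one joined to all of C by edges of colour 1 only,
-- those of the other by edges of colour 2 only, and F runs between the classes.
-- An alternating walk that leaves C for the components dominating C then
-- alternates between classes and can reach each vertex there by one colour only,
-- so that G is not trail-colour-connected.
module Submission where

open import Defs
open import Data.Bool using (Bool; true; false; not; if_then_else_; _∧_)
open import Data.Bool.Properties using (not-involutive) renaming (_≟_ to _≟ᵇ_)
open import Data.Empty using (⊥; ⊥-elim)
open import Data.Fin using (Fin; zero; suc; _≟_; fromℕ<; punchIn; punchOut)
open import Data.Fin.Properties using (any?; all?; injective⇒≤; punchInᵢ≢i; punchIn-punchOut; ¬∀⟶∃¬)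
open import Data.Integer as ℤ using (ℤ; _+_; _-_; _*_; -_; 0ℤ; 1ℤ; -1ℤ; _≤_)
import Data.Integer.Properties as ℤ
open import Data.Integer.Tactic.RingSolver using (solve-∀)
open import Data.List using (List; []; _∷_; _++_; reverse; length; lookup; concat; head; last; map; tabulate)
open import Data.List.Membership.Propositional using (_∈_; _∉_; find)
open import Data.List.Membership.Propositional.Properties using (∈-lookup; ∈-map⁻; ∈-concat⁺′; ∈-tabulate⁺)
open import Data.List.Properties using (length-++; unfold-reverse)
open import Data.List.Relation.Binary.Permutation.Propositional using (_↭_; ↭-sym; ↭-refl; ↭⇒↭ₛ)
open import Data.List.Relation.Binary.Permutation.Propositional.Properties
  using (++⁺ˡ; ++-comm; ↭-reverse; All-resp-↭; Any-resp-↭; ↭-length)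
import Data.List.Relation.Binary.Permutation.Setoid.Properties as Permutationₛ
open import Data.List.Relation.Unary.All as All using (All; []; _∷_)
import Data.List.Relation.Unary.All.Properties as All
open import Data.List.Relation.Unary.AllPairs using ([]; _∷_)
import Data.List.Relation.Unary.AllPairs.Properties as AllPairs
open import Data.List.Relation.Unary.Any as Any using (Any; here; there)
import Data.List.Relation.Unary.Any.Properties as Any
open import Data.List.Relation.Unary.Linked using (Linked; [-]; _∷_)
open import Data.List.Relation.Unary.Unique.Propositional using (Unique)
import Data.List.Relation.Unary.Unique.Propositional.Properties as Unique
open import Data.Maybe using (just)
open import Data.Nat as ℕ using (ℕ; zero; suc)
import Data.Nat.Properties as ℕ
open import Data.Product using (Σ-syntax; ∃; ∃-syntax; _×_; _,_; proj₁; proj₂)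
open import Data.Sum as Sum using (_⊎_; inj₁; inj₂; [_,_]′)
open import Data.Vec.Functional using (removeAt) renaming (_∷_ to _◂_; [] to ⟨⟩)
open import Function using (_∘_; id; case_of_)
open import Function.Bundles using (_⇔_; mk⇔; module Inverse)
open import Relation.Binary.PropositionalEquality
open import Relation.Nullary using (¬_; Dec; yes; no; does)
open import Relation.Nullary.Decidable using (map′; _⊎-dec_; _×-dec_; ¬?; decidable-stable; dec-true; dec-false)
open import Algebra.Properties.CommutativeMonoid.Sum ℤ.+-0-commutativeMonoid
  using (sum; sum-remove; sum-cong-≗; sum-replicate-zero)

-- The improvements are of four kinds: adding an alternating circuit built from edges across a cut,
-- swapping two edges of one colour between components, inserting a vertex into two edges, and
-- replacing an edge by a path of three edges. M-closedness speaks only about two edges of one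
-- colour at a vertex, so it carries a fact along an edge of F only if that edge has the right
-- colour. Counting supplies the other half: a rule that leads from class `s` to class `op s` along
-- the edges of colour `s` does so, by balance, along all edges of F (`alternating-classes`). Facts
-- about domination spread through a component in this way. M-closedness also says nothing about two
-- copies of one vertex. Such copies never lie in different components, since they could swap edges
-- (`adjacent`). Domination might be cyclic on three components; replacing an edge by a path rules
-- this out (`trapped-step`). Connectivity is defined by cuts, which makes it and the existence of a
-- solution decidable, so that a proof by contradiction can stand in for the choice of an extremal
-- F.

-- Search over Boolean functions, sums of integers

-- `resp` is there because a function on `Fin (suc n)` agrees with its head put before its tail only
-- pointwise.
anyBool? : ∀ {n} {P : (Fin n → Bool) → Set} → (∀ {f g} → f ≗ g → P f → P g) →
           (∀ f → Dec (P f)) → Dec (∃ P)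
anyBool? {zero}  resp P? = map′ (⟨⟩ ,_) (λ (f , p) → resp (λ ()) p) (P? ⟨⟩)
anyBool? {suc n} {P} resp P? =
  map′ [ (λ (f , p) → true ◂ f , p) , (λ (f , p) → false ◂ f , p) ]′ split
    (anyBool? {P = P ∘ (true ◂_)} (resp ∘ ext) (P? ∘ (true ◂_))
      ⊎-dec anyBool? {P = P ∘ (false ◂_)} (resp ∘ ext) (P? ∘ (false ◂_)))
  where
  ext : ∀ {b} {f g : Fin n → Bool} → f ≗ g → (b ◂ f) ≗ (b ◂ g)
  ext f≗g zero    = refl
  ext f≗g (suc i) = f≗g i

  uncons : ∀ {f : Fin (suc n) → Bool} {b} → f zero ≡ b → f ≗ (b ◂ (f ∘ suc))
  uncons eq zero    = eq
  uncons eq (suc i) = refl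

  split : ∃ P → _
  split (f , p) with f zero in eq
  ... | true  = inj₁ (f ∘ suc , resp (uncons eq) p)
  ... | false = inj₂ (f ∘ suc , resp (uncons eq) p)

sum-update : ∀ {n} {f g : Fin n → ℤ} i → (∀ j → j ≢ i → g j ≡ f j) →
             sum g ≡ sum f + (g i - f i)
sum-update {suc n} {f} {g} i same = begin
  sum g                                    ≡⟨ sum-remove {i = i} g ⟩
  g i + sum (removeAt g i)                 ≡⟨ cong (g i +_) (sum-cong-≗ λ j → same (punchIn i j) (punchInᵢ≢i i j)) ⟩
  g i + sum (removeAt f i)                 ≡⟨ lemma (f i) (g i) _ ⟩
  (f i + sum (removeAt f i)) + (g i - f i) ≡⟨ cong (_+ (g i - f i)) (sym (sum-remove {i = i} f)) ⟩
  sum f + (g i - f i)                      ∎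
  where
  open ≡-Reasoning
  lemma : ∀ a b c → b + c ≡ (a + c) + (b - a)
  lemma = solve-∀

sum-nonneg : ∀ {n} {f : Fin n → ℤ} → (∀ i → 0ℤ ≤ f i) → 0ℤ ≤ sum f
sum-nonneg {zero}  _ = ℤ.≤-refl
sum-nonneg {suc n} p = ℤ.+-mono-≤ (p zero) (sum-nonneg (p ∘ suc))

summand-zero : ∀ {a b} → 0ℤ ≤ a → 0ℤ ≤ b → a + b ≡ 0ℤ → a ≡ 0ℤ
summand-zero {a} 0≤a 0≤b eq =
  ℤ.≤-antisym (subst₂ _≤_ (ℤ.+-identityʳ a) eq (ℤ.+-monoʳ-≤ a 0≤b)) 0≤a

sum-nonneg-zero : ∀ {n} {f : Fin n → ℤ} → (∀ i → 0ℤ ≤ f i) → sum f ≡ 0ℤ → ∀ i → f i ≡ 0ℤ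
sum-nonneg-zero p eq zero = summand-zero (p zero) (sum-nonneg (p ∘ suc)) eq
sum-nonneg-zero {f = f} p eq (suc i) = sum-nonneg-zero (p ∘ suc) rest i
  where
  rest = trans (sym (ℤ.+-identityˡ _))
           (trans (cong (_+ sum (f ∘ suc)) (sym (sum-nonneg-zero p eq zero))) eq)

Even : ℤ → Set
Even x = ∃[ y ] x ≡ y + y

sum-even : ∀ {n} {f : Fin n → ℤ} → (∀ i → Even (f i)) → Even (sum f)
sum-even {zero}  p = 0ℤ , refl
sum-even {suc n} p with p zero | sum-even (p ∘ suc)
... | y , eq | z , eq′ = y + z , trans (cong₂ _+_ eq eq′) (lemma y z)
  where
  lemma : ∀ y z → (y + y) + (z + z) ≡ (y + z) + (y + z)
  lemma = solve-∀

-- Colours and signs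

Colour : Set
Colour = Fin 2

op : Colour → Colour
op zero       = suc zero
op (suc zero) = zero

op-≢ : ∀ s → op s ≢ s
op-≢ zero       ()
op-≢ (suc zero) ()

op-op : ∀ s → op (op s) ≡ s
op-op zero       = refl
op-op (suc zero) = refl

≢⇒≡op : ∀ {s t} → s ≢ t → t ≡ op s
≢⇒≡op {zero}     {zero}     n = ⊥-elim (n refl)
≢⇒≡op {zero}     {suc zero} n = refl
≢⇒≡op {suc zero} {zero}     n = refl
≢⇒≡op {suc zero} {suc zero} n = ⊥-elim (n refl)

≡⊎≡op : ∀ s t → (t ≡ s) ⊎ (t ≡ op s)
≡⊎≡op s t with s ≟ t
... | yes s≡t = inj₁ (sym s≡t)
... | no  s≢t = inj₂ (≢⇒≡op s≢t)

sgn : Colour → ℤ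
sgn zero       = 1ℤ
sgn (suc zero) = -1ℤ

sgn-op : ∀ s → sgn (op s) ≡ - sgn s
sgn-op zero       = refl
sgn-op (suc zero) = refl

ind : ∀ {n} → (Fin n → Bool) → Fin n → ℤ
ind S v = if S v then 1ℤ else 0ℤ

-- Alternating arcs

module Trails (G : Graph) where
  open Graph G

  joins-sym : ∀ {e u v} → Joins e u v → Joins e v u
  joins-sym = Sum.swap

  ends : ∀ e → Joins e (src e) (tgt e)
  ends e = inj₁ (refl , refl)

  joins-≢ : ∀ {e u v} → Joins e u v → u ≢ v
  joins-≢ {e} (inj₁ (refl , refl)) = loopless e
  joins-≢ {e} (inj₂ (refl , refl)) = loopless e ∘ sym

  joins-end : ∀ {e u v x y} → Joins e u v → Joins e x y → (x ≡ u × y ≡ v) ⊎ (x ≡ v × y ≡ u)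
  joins-end (inj₁ (refl , refl)) (inj₁ (refl , refl)) = inj₁ (refl , refl)
  joins-end (inj₁ (refl , refl)) (inj₂ (refl , refl)) = inj₂ (refl , refl)
  joins-end (inj₂ (refl , refl)) (inj₁ (refl , refl)) = inj₂ (refl , refl)
  joins-end (inj₂ (refl , refl)) (inj₂ (refl , refl)) = inj₁ (refl , refl)

  Joins? : ∀ e u v → Dec (Joins e u v)
  Joins? e u v = ((src e ≟ u) ×-dec (tgt e ≟ v)) ⊎-dec ((src e ≟ v) ×-dec (tgt e ≟ u))

  Meets : V → E → Set
  Meets x e = src e ≡ x ⊎ tgt e ≡ x

  Meets? : ∀ x e → Dec (Meets x e)
  Meets? x e = (src e ≟ x) ⊎-dec (tgt e ≟ x)

  meets-end : ∀ {e u v x} → Joins e u v → Meets x e → (x ≡ u) ⊎ (x ≡ v)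
  meets-end (inj₁ (refl , refl)) = Sum.map sym sym
  meets-end (inj₂ (refl , refl)) = Sum.swap ∘ Sum.map sym sym

  joins-meets : ∀ {e u v} → Joins e u v → Meets u e
  joins-meets = Sum.map proj₁ proj₂

  -- An alternating walk from u to v with the given edges; s and t are the
  -- colours of its first and last edge.
  data Arc : V → Colour → List E → V → Colour → Set where
    single : ∀ {u v e s} → Joins e u v → colour e ≡ s → Arc u s (e ∷ []) v s
    cons   : ∀ {u v w e es r s t} → Joins e u v → colour e ≡ r → r ≢ s →
             Arc v s es w t → Arc u r (e ∷ es) w t

  append : ∀ {u v w s t t′ r es fs} → Arc u s es v t → t ≢ t′ → Arc v t′ fs w r →
           Arc u s (es ++ fs) w r
  append (single j c)   n b = cons j c n b
  append (cons j c m a) n b = cons j c m (append a n b)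

  arc-reverse : ∀ {u v s t es} → Arc u s es v t → Arc v t (reverse es) u s
  arc-reverse (single j c) = single (joins-sym j) c
  arc-reverse {es = e ∷ es} (cons j c m a) =
    subst (λ fs → Arc _ _ fs _ _) (sym (unfold-reverse e es))
      (append (arc-reverse a) (m ∘ sym) (single (joins-sym j) c))

  Incident : V → List E → Set
  Incident x = Any (Meets x)

  incident? : ∀ x es → Dec (Incident x es)
  incident? x = Any.any? (Meets? x)

  data Split (u : V) (s : Colour) (es : List E) (v : V) (t : Colour) (x : V) : Set where
    at-start : x ≡ u → Split u s es v t x
    at-end   : x ≡ v → Split u s es v t x
    inside   : ∀ es₁ es₂ {r r′} → es ≡ es₁ ++ es₂ → r ≢ r′ →
               Arc u s es₁ x r → Arc x r′ es₂ v t → Split u s es v t x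

  split : ∀ {u s es v t x} → Arc u s es v t → Incident x es → Split u s es v t x
  split (single j c) (here m) = [ at-start , at-end ]′ (meets-end j m)
  split {es = e ∷ es} (cons j c n a) (here m) with meets-end j m
  ... | inj₁ eq   = at-start eq
  ... | inj₂ refl = inside (e ∷ []) es refl n (single j c) a
  split {es = e ∷ es} (cons j c n a) (there i) with split a i
  ... | at-start refl                = inside (e ∷ []) es refl n (single j c) a
  ... | at-end eq                    = at-end eq
  ... | inside es₁ es₂ refl n′ a₁ a₂ = inside (e ∷ es₁) es₂ refl n′ (cons j c n a₁) a₂

  arc-incident-start : ∀ {u s es v t} → Arc u s es v t → Incident u es
  arc-incident-start (single j _)   = here (joins-meets j)
  arc-incident-start (cons j _ _ _) = here (joins-meets j)

  -- Signed degrees of edge sets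

  -- Summed over a set of edges, this is the sum over the vertices `v` of `g v` times the excess at
  -- `v` of colour `zero` over the other colour.
  Δ : (V → ℤ) → E → ℤ
  Δ g e = sgn (colour e) * (g (src e) + g (tgt e))

  Δ-joins : ∀ g {e u v s} → Joins e u v → colour e ≡ s → Δ g e ≡ sgn s * (g u + g v)
  Δ-joins g (inj₁ (refl , refl)) refl = refl
  Δ-joins g {e} (inj₂ (refl , refl)) refl = cong (sgn (colour e) *_) (ℤ.+-comm (g (src e)) _)

  total : (V → ℤ) → List E → ℤ
  total g []       = 0ℤ
  total g (e ∷ es) = Δ g e + total g es

  -- Consecutive edges have opposite signs, so the inner vertices cancel.
  total-arc : ∀ g {u s es v t} → Arc u s es v t → total g es ≡ sgn s * g u + sgn t * g v
  total-arc g {u} {s} {v = v} (single j c) =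
    trans (cong (_+ 0ℤ) (Δ-joins g j c)) (lemma (sgn s) (g u) (g v))
    where
    lemma : ∀ a b c → a * (b + c) + 0ℤ ≡ a * b + a * c
    lemma = solve-∀
  total-arc g {u} {r} {v = w} {t} (cons {v = v} {s = s} j c n a) =
    trans (cong₂ _+_ (Δ-joins g j c) (total-arc g a))
      (trans (cong (λ x → sgn r * (g u + g v) + (x * g v + sgn t * g w))
                   (trans (cong sgn (≢⇒≡op n)) (sgn-op r)))
             (lemma (sgn r) (g u) (g v) (sgn t) (g w)))
    where
    lemma : ∀ a b c d e → a * (b + c) + ((- a) * c + d * e) ≡ a * b + d * e
    lemma = solve-∀

  total-closed : ∀ g {u s es t} → Arc u s es u t → s ≢ t → total g es ≡ 0ℤ
  total-closed g {u} {s} {t = t} a n =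
    trans (total-arc g a)
      (trans (cong (λ x → sgn s * g u + x * g u) (trans (cong sgn (≢⇒≡op n)) (sgn-op s)))
             (lemma (sgn s) (g u)))
    where
    lemma : ∀ a b → a * b + (- a) * b ≡ 0ℤ
    lemma = solve-∀

  total-++ : ∀ g es fs → total g (es ++ fs) ≡ total g es + total g fs
  total-++ g []       fs = sym (ℤ.+-identityˡ _)
  total-++ g (e ∷ es) fs = trans (cong (Δ g e +_) (total-++ g es fs)) (sym (ℤ.+-assoc (Δ g e) _ _))

  total-concat : ∀ g {ess} → All (λ es → total g es ≡ 0ℤ) ess → total g (concat ess) ≡ 0ℤ
  total-concat g [] = refl
  total-concat g (_∷_ {es} {ess} p ps) = trans (total-++ g es (concat ess)) (cong₂ _+_ p (total-concat g ps))

  EdgeSet : Set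
  EdgeSet = E → Bool

  weigh : EdgeSet → (V → ℤ) → E → ℤ
  weigh F g e = if F e then Δ g e else 0ℤ

  bal : EdgeSet → (V → ℤ) → ℤ
  bal F g = sum (weigh F g)

  -- For S = {v} this says that v has as many edges of either colour in F.
  Balanced : EdgeSet → Set
  Balanced F = ∀ S → bal F (ind S) ≡ 0ℤ

  bal-cong : ∀ F {g h} → g ≗ h → bal F g ≡ bal F h
  bal-cong F {g} {h} eq = sum-cong-≗ λ e → cong (λ x → if F e then x else 0ℤ)
    (cong (sgn (colour e) *_) (cong₂ _+_ (eq (src e)) (eq (tgt e))))

  bal-linear : ∀ F a b g h → bal F (λ v → a * g v + b * h v) ≡ a * bal F g + b * bal F h
  bal-linear F a b g h = trans (sum-cong-≗ pointwise) (sum-linear (weigh F g) (weigh F h))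
    where
    lemma : ∀ a b s x y z w → s * ((a * x + b * y) + (a * z + b * w)) ≡ a * (s * (x + z)) + b * (s * (y + w))
    lemma = solve-∀
    zeros : ∀ a b → 0ℤ ≡ a * 0ℤ + b * 0ℤ
    zeros = solve-∀
    pointwise : ∀ e → weigh F (λ v → a * g v + b * h v) e ≡ a * weigh F g e + b * weigh F h e
    pointwise e with F e
    ... | true  = lemma a b (sgn (colour e)) (g (src e)) (h (src e)) (g (tgt e)) (h (tgt e))
    ... | false = zeros a b
    assoc : ∀ a b x y u v → (a * x + b * y) + (a * u + b * v) ≡ a * (x + u) + b * (y + v)
    assoc = solve-∀
    sum-linear : ∀ {n} (f k : Fin n → ℤ) → sum (λ i → a * f i + b * k i) ≡ a * sum f + b * sum k
    sum-linear {zero}  f k = zeros a b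
    sum-linear {suc n} f k = trans (cong (a * f zero + b * k zero +_) (sum-linear (f ∘ suc) (k ∘ suc)))
      (assoc a b (f zero) (k zero) _ _)

  balanced-linear : ∀ {F} → Balanced F → ∀ a b S T → bal F (λ v → a * ind S v + b * ind T v) ≡ 0ℤ
  balanced-linear {F} balF a b S T =
    trans (bal-linear F a b (ind S) (ind T))
      (trans (cong₂ (λ x y → a * x + b * y) (balF S) (balF T)) (lemma a b))
    where
    lemma : ∀ a b → a * 0ℤ + b * 0ℤ ≡ 0ℤ
    lemma = solve-∀

  _[_≔_] : EdgeSet → E → Bool → EdgeSet
  (F [ e ≔ b ]) f = if does (f ≟ e) then b else F f

  update-≡ : ∀ F e b → (F [ e ≔ b ]) e ≡ b
  update-≡ F e b rewrite dec-true (e ≟ e) refl = refl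

  update-≢ : ∀ F {e b f} → f ≢ e → (F [ e ≔ b ]) f ≡ F f
  update-≢ F {e} {b} {f} n rewrite dec-false (f ≟ e) n = refl

  setAll : Bool → List E → EdgeSet → EdgeSet
  setAll b []       F = F
  setAll b (e ∷ es) F = setAll b es F [ e ≔ b ]

  setAll-∈ : ∀ {b F e} es → e ∈ es → setAll b es F e ≡ b
  setAll-∈ {b} {F} {e} (f ∷ es) i with e ≟ f | i
  ... | yes _  | _       = refl
  ... | no e≢f | here eq = ⊥-elim (e≢f eq)
  ... | no e≢f | there i = setAll-∈ es i

  setAll-∉ : ∀ {b F e} es → e ∉ es → setAll b es F e ≡ F e
  setAll-∉ []       n = refl
  setAll-∉ {b} {F} {e} (f ∷ es) n with e ≟ f
  ... | yes eq = ⊥-elim (n (here eq))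
  ... | no _   = setAll-∉ es (n ∘ there)

  bal-setAll-true : ∀ {F} g {es} → Unique es → All (λ e → F e ≡ false) es →
                    bal (setAll true es F) g ≡ bal F g + total g es
  bal-setAll-true g [] [] = sym (ℤ.+-identityʳ _)
  bal-setAll-true {F} g {e ∷ es} (e∉ ∷ u) (Fe ∷ Fes) =
    trans (sum-update e λ f f≢e → cong (λ b → if b then Δ g f else 0ℤ) (update-≢ F′ f≢e))
      (trans (cong₂ (λ b c → bal F′ g + ((if b then Δ g e else 0ℤ) - (if c then Δ g e else 0ℤ)))
                    (update-≡ F′ e true) (trans (setAll-∉ es (All.All¬⇒¬Any e∉)) Fe))
        (trans (cong (_+ (Δ g e - 0ℤ)) (bal-setAll-true g u Fes)) (lemma (bal F g) (Δ g e) (total g es))))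
    where
    F′ = setAll true es F
    lemma : ∀ a b c → (a + c) + (b - 0ℤ) ≡ a + (b + c)
    lemma = solve-∀

  bal-setAll-false : ∀ {F} g {es} → Unique es → All (λ e → F e ≡ true) es →
                     bal (setAll false es F) g ≡ bal F g - total g es
  bal-setAll-false g [] [] = sym (ℤ.+-identityʳ _)
  bal-setAll-false {F} g {e ∷ es} (e∉ ∷ u) (Fe ∷ Fes) =
    trans (sum-update e λ f f≢e → cong (λ b → if b then Δ g f else 0ℤ) (update-≢ F′ f≢e))
      (trans (cong₂ (λ b c → bal F′ g + ((if b then Δ g e else 0ℤ) - (if c then Δ g e else 0ℤ)))
                    (update-≡ F′ e false) (trans (setAll-∉ es (All.All¬⇒¬Any e∉)) Fe))
        (trans (cong (_+ (0ℤ - Δ g e)) (bal-setAll-false g u Fes)) (lemma (bal F g) (Δ g e) (total g es))))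
    where
    F′ = setAll false es F
    lemma : ∀ a b c → (a - c) + (0ℤ - b) ≡ a - (b + c)
    lemma = solve-∀

  -- Connectivity by cuts

  ClosedAt : (V → Bool) → E → Set
  ClosedAt S e = S (src e) ≡ S (tgt e)

  Closed : EdgeSet → (V → Bool) → Set
  Closed F S = ∀ e → F e ≡ true → ClosedAt S e

  -- Connectivity in (V , F) as inseparability by cuts.
  Conn : EdgeSet → V → V → Set
  Conn F u v = ∀ S → Closed F S → S u ≡ S v

  Connected : EdgeSet → Set
  Connected F = ∀ u v → Conn F u v

  closedAt⇒≡ : ∀ S {e u v} → Joins e u v → ClosedAt S e → S u ≡ S v
  closedAt⇒≡ S (inj₁ (refl , refl)) = id
  closedAt⇒≡ S (inj₂ (refl , refl)) = sym

  ≡⇒closedAt : ∀ S {e u v} → Joins e u v → S u ≡ S v → ClosedAt S e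
  ≡⇒closedAt S (inj₁ (refl , refl)) = id
  ≡⇒closedAt S (inj₂ (refl , refl)) = sym

  conn-refl : ∀ {F u} → Conn F u u
  conn-refl _ _ = refl

  conn-trans : ∀ {F u v w} → Conn F u v → Conn F v w → Conn F u w
  conn-trans c d S cl = trans (c S cl) (d S cl)

  edge-conn : ∀ {F e u v} → F e ≡ true → Joins e u v → Conn F u v
  edge-conn Fe j S cl = closedAt⇒≡ S j (cl _ Fe)

  arc-conn : ∀ {F u s es v t x} → Arc u s es v t → All (λ e → F e ≡ true) es →
             Incident x es → Conn F u x
  arc-conn (single j _) (Fe ∷ []) (here m) with meets-end j m
  ... | inj₁ refl = conn-refl
  ... | inj₂ refl = edge-conn Fe j
  arc-conn (cons j _ _ a) (Fe ∷ Fes) (here m) with meets-end j m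
  ... | inj₁ refl = conn-refl
  ... | inj₂ refl = edge-conn Fe j
  arc-conn {x = x} (cons {u = u} {v = v} j _ _ a) (Fe ∷ Fes) (there i) = conn-trans {u = u} {v} {x} (edge-conn Fe j) (arc-conn a Fes i)

  closed? : ∀ F S → Dec (Closed F S)
  closed? F S = map′ (λ f e Fe → decidable-stable (_ ≟ᵇ _) λ n → f (e , Fe , n))
                     (λ cl (e , Fe , n) → n (cl e Fe))
                     (¬? (any? λ e → (F e ≟ᵇ true) ×-dec ¬? (S (src e) ≟ᵇ S (tgt e))))

  closed-resp : ∀ {F S T} → S ≗ T → Closed F S → Closed F T
  closed-resp eq cl e Fe = trans (sym (eq (src e))) (trans (cl e Fe) (eq (tgt e)))

  separate? : ∀ F u v → Dec (∃[ S ] Closed F S × S u ≢ S v)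
  separate? F u v = anyBool?
    (λ {S} {T} eq (cl , n) → closed-resp {F} {S} {T} eq cl , λ m → n (trans (eq u) (trans m (sym (eq v)))))
    (λ S → closed? F S ×-dec ¬? (S u ≟ᵇ S v))

  conn? : ∀ F u v → Dec (Conn F u v)
  conn? F u v = map′ (λ n S cl → decidable-stable (_ ≟ᵇ _) λ m → n (S , cl , m))
                     (λ c (S , cl , m) → m (c S cl)) (¬? (separate? F u v))

  cut : ∀ {F u v} → ¬ Conn F u v → ∃[ S ] Closed F S × S u ≡ true × S v ≡ false
  cut {F} {u} {v} ¬c with separate? F u v
  ... | no n = ⊥-elim (¬c λ S cl → decidable-stable (_ ≟ᵇ _) λ m → n (S , cl , m))
  ... | yes (S , cl , m) with S u in eq | S v in eq′
  ...   | true  | true  = ⊥-elim (m refl)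
  ...   | true  | false = S , cl , eq , eq′
  ...   | false | false = ⊥-elim (m refl)
  ...   | false | true  = not ∘ S , (λ e Fe → cong not (cl e Fe)) , cong not eq , cong not eq′

  -- The vertices with property `P` form a cut that no edge of F crosses; `P` is decidable because
  -- cuts are Boolean.
  conn-induct : ∀ {F} {P : V → Set} → (∀ v → Dec (P v)) →
                (∀ {e u v} → F e ≡ true → Joins e u v → P u → P v) →
                ∀ {u v} → Conn F u v → P u → P v
  conn-induct {F} {P} P? next {u} {v} c pu = does⇒ (P? v) (trans (sym (c S closed)) (dec-true (P? u) pu))
    where
    S : V → Bool
    S w = does (P? w)
    does⇒ : ∀ {A : Set} (A? : Dec A) → does A? ≡ true → A
    does⇒ (yes a) _ = a
    closed : Closed F S
    closed e Fe with P? (src e) | P? (tgt e)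
    ... | yes _ | yes _ = refl
    ... | no _  | no _  = refl
    ... | yes p | no n  = ⊥-elim (n (next Fe (ends e) p))
    ... | no n  | yes p = ⊥-elim (n (next Fe (joins-sym (ends e)) p))

  conn-mono : ∀ {F F′} → (∀ e → F e ≡ true → Conn F′ (src e) (tgt e)) → ∀ {u v} → Conn F u v → Conn F′ u v
  conn-mono h c S cl = c S λ e Fe → h e Fe S cl

  connected? : ∀ F → Dec (Connected F)
  connected? F = all? λ u → all? λ v → conn? F u v

  bal-respˡ : ∀ {F F′} → F ≗ F′ → ∀ g → bal F g ≡ bal F′ g
  bal-respˡ eq g = sum-cong-≗ λ e → cong (λ b → if b then Δ g e else 0ℤ) (eq e)

  balanced? : ∀ F → Dec (Balanced F)
  balanced? F = map′ (λ n S → decidable-stable (_ ℤ.≟ _) λ m → n (S , m)) (λ b (S , m) → m (b S))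
    (¬? (anyBool? (λ {S} {T} eq n m → n (trans (bal-cong F λ v → cong (λ b → if b then 1ℤ else 0ℤ) (eq v)) m))
                  (λ S → ¬? (bal F (ind S) ℤ.≟ 0ℤ))))

  Solution : Set
  Solution = ∃[ F ] Balanced F × Connected F

  -- Lets a doubly negated solution be used as a solution.
  solution? : Dec Solution
  solution? = anyBool?
    (λ {F} {F′} eq (b , c) → (λ S → trans (sym (bal-respˡ eq (ind S))) (b S)) ,
      λ u v S cl → c u v S λ e Fe → cl e (trans (sym (eq e)) Fe))
    (λ F → balanced? F ×-dec connected? F)

private variable X : Set

unique-++⁻ : ∀ (xs : List X) {ys} → Unique (xs ++ ys) → Unique xs × Unique ys
unique-++⁻ []       u = [] , u
unique-++⁻ (x ∷ xs) (x∉ ∷ u) with unique-++⁻ xs u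
... | u₁ , u₂ = All.++⁻ˡ xs x∉ ∷ u₁ , u₂

unique-resp-↭ : {xs ys : List X} → xs ↭ ys → Unique xs → Unique ys
unique-resp-↭ p = Permutationₛ.Unique-resp-↭ (setoid _) (↭⇒↭ₛ p)

unique-lookup-injective : {xs : List X} → Unique xs → ∀ {i j} → lookup xs i ≡ lookup xs j → i ≡ j
unique-lookup-injective (x∉ ∷ u) {zero}  {zero}  eq = refl
unique-lookup-injective (x∉ ∷ u) {zero}  {suc j} eq = ⊥-elim (All.lookup x∉ (∈-lookup j) eq)
unique-lookup-injective (x∉ ∷ u) {suc i} {zero}  eq = ⊥-elim (All.lookup x∉ (∈-lookup i) (sym eq))
unique-lookup-injective (x∉ ∷ u) {suc i} {suc j} eq = cong suc (unique-lookup-injective u eq)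

unique-length : ∀ {n} {xs : List (Fin n)} → Unique xs → length xs ℕ.≤ n
unique-length u = injective⇒≤ (unique-lookup-injective u)

-- Kotzig's theorem

module Circuits (G : Graph) where
  open Graph G
  open Trails G

  Circuit : V → List E → Set
  Circuit u es = ∃[ s ] ∃[ t ] s ≢ t × Arc u s es u t

  rotate : ∀ {u es x} → Circuit u es → Incident x es → ∃[ fs ] Circuit x fs × fs ↭ es
  rotate c@(s , t , s≢t , a) i with split a i
  ... | at-start refl = _ , c , ↭-refl
  ... | at-end refl   = _ , c , ↭-refl
  ... | inside es₁ es₂ refl r≢r′ a₁ a₂ =
    es₂ ++ es₁ , (_ , _ , r≢r′ ∘ sym , append a₂ (s≢t ∘ sym) a₁) , ++-comm es₂ es₁

  In : EdgeSet → List E → Set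
  In H = All λ e → H e ≡ true

  -- The weight `sgn r` at `p` cancels the sign of every edge there. The vanishing second summand
  -- gives the weight the shape that `balanced-linear` expects.
  only-colour-nonneg : ∀ {H p r} → (∀ e → H e ≡ true → Meets p e → colour e ≡ r) →
                       0ℤ ≤ bal H λ v → sgn r * ind (λ v → does (p ≟ v)) v + 0ℤ * ind (λ v → does (p ≟ v)) v
  only-colour-nonneg {H} {p} {r} only = sum-nonneg at-edge
    where
    δ : V → ℤ
    δ = ind λ v → does (p ≟ v)
    g : V → ℤ
    g v = sgn r * δ v + 0ℤ * δ v
    same : ∀ r b c → 0ℤ ≤ sgn r * ((sgn r * (if b then 1ℤ else 0ℤ) + 0ℤ * (if b then 1ℤ else 0ℤ))
                                 + (sgn r * (if c then 1ℤ else 0ℤ) + 0ℤ * (if c then 1ℤ else 0ℤ)))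
    same zero       true  true  = ℤ.+≤+ ℕ.z≤n
    same zero       true  false = ℤ.+≤+ ℕ.z≤n
    same zero       false true  = ℤ.+≤+ ℕ.z≤n
    same zero       false false = ℤ.+≤+ ℕ.z≤n
    same (suc zero) true  true  = ℤ.+≤+ ℕ.z≤n
    same (suc zero) true  false = ℤ.+≤+ ℕ.z≤n
    same (suc zero) false true  = ℤ.+≤+ ℕ.z≤n
    same (suc zero) false false = ℤ.+≤+ ℕ.z≤n
    vanish : ∀ c s → c * ((s * 0ℤ + 0ℤ * 0ℤ) + (s * 0ℤ + 0ℤ * 0ℤ)) ≡ 0ℤ
    vanish = solve-∀
    at-edge : ∀ e → 0ℤ ≤ weigh H g e
    at-edge e with H e in He
    ... | false = ℤ.≤-refl
    ... | true with Meets? p e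
    ...   | yes m rewrite only e He m = same r (does (p ≟ src e)) (does (p ≟ tgt e))
    ...   | no ¬m rewrite dec-false (p ≟ src e) (¬m ∘ inj₁ ∘ sym) | dec-false (p ≟ tgt e) (¬m ∘ inj₂ ∘ sym) =
      ℤ.≤-reflexive (sym (vanish (sgn (colour e)) (sgn r)))

  -- An open alternating trail in a balanced edge set can be prolonged by an
  -- unused edge: removing the trail leaves a deficit at its end.
  prolong : ∀ {H} → Balanced H → ∀ {p r es a t} → Arc p r es a t → Unique es → In H es →
            ¬ (p ≡ a × r ≢ t) →
            ∃[ e ] ∃[ q ] H e ≡ true × e ∉ es × Joins e q p × colour e ≡ op r
  prolong {H} balH {p} {r} {es} {a} {t} arc u Hes open′
    with any? (λ e → (H e ≟ᵇ true) ×-dec ¬? (Any.any? (e ≟_) es) ×-dec Meets? p e ×-dec (colour e ≟ op r))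
  ... | yes (e , He , e∉ , inj₁ m , c) = e , tgt e , He , e∉ , inj₂ (m , refl) , c
  ... | yes (e , He , e∉ , inj₂ m , c) = e , src e , He , e∉ , inj₁ (refl , m) , c
  ... | no none = ⊥-elim (negative (subst (0ℤ ≤_) value (only-colour-nonneg only)))
    where
    H′ = setAll false es H
    S : V → Bool
    S v = does (p ≟ v)
    g : V → ℤ
    g v = sgn r * ind S v + 0ℤ * ind S v
    only : ∀ e → H′ e ≡ true → Meets p e → colour e ≡ r
    only e H′e m with colour e ≟ r | Any.any? (e ≟_) es
    ... | yes c | _ = c
    ... | no _  | yes e∈ = case trans (sym H′e) (setAll-∈ es e∈) of λ ()
    ... | no ¬c | no e∉  = ⊥-elim (none (e , trans (sym (setAll-∉ es e∉)) H′e , e∉ , m , ≢⇒≡op (¬c ∘ sym)))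
    value : bal H′ g ≡ 0ℤ - (sgn r * g p + sgn t * g a)
    value = trans (bal-setAll-false g u Hes)
      (cong₂ _-_ (balanced-linear balH (sgn r) 0ℤ S S) (total-arc g arc))
    elsewhere : ∀ r t → ¬ (0ℤ ≤ 0ℤ - (sgn r * (sgn r * 1ℤ + 0ℤ * 1ℤ) + sgn t * (sgn r * 0ℤ + 0ℤ * 0ℤ)))
    elsewhere zero       zero       ()
    elsewhere zero       (suc zero) ()
    elsewhere (suc zero) zero       ()
    elsewhere (suc zero) (suc zero) ()
    returned : ∀ r → ¬ (0ℤ ≤ 0ℤ - (sgn r * (sgn r * 1ℤ + 0ℤ * 1ℤ) + sgn r * (sgn r * 1ℤ + 0ℤ * 1ℤ)))
    returned zero       ()
    returned (suc zero) ()
    -- The end `p` counts `sgn r * sgn r`, which is 1. The end `a` counts 0 if it differs from `p`,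
    -- and again 1 if it is `p` and `r` is `t`; so the value is -1 or -2.
    negative : ¬ (0ℤ ≤ 0ℤ - (sgn r * g p + sgn t * g a))
    negative with p ≟ a
    ... | no p≢a rewrite dec-true (p ≟ p) refl = elsewhere r t
    ... | yes refl with r ≟ t
    ...   | no r≢t = ⊥-elim (open′ (refl , r≢t))
    ...   | yes refl rewrite dec-true (p ≟ p) refl = returned r

  -- The arc grows at its front, while its end `a` and last colour `t` stay fixed. The fuel `n` can
  -- run out only on a trail with more edges than the graph.
  close : ∀ {H} → Balanced H → ∀ n {p r es a t} → Arc p r es a t → Unique es → In H es →
          size ℕ.< n ℕ.+ length es →
          ∃[ q ] ∃[ fs ] Arc a q fs a t × q ≢ t × Unique fs × In H fs
  close balH zero arc u Hes lt = ⊥-elim (ℕ.<⇒≱ lt (unique-length u))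
  close balH (suc n) {p} {r} {es} {a} {t} arc u Hes lt with (p ≟ a) ×-dec ¬? (r ≟ t)
  ... | yes (refl , r≢t) = r , es , arc , r≢t , u , Hes
  ... | no open′ with prolong balH arc u Hes open′
  ...   | e , q , He , e∉ , j , c =
    close balH n (cons j c (op-≢ r) arc) (All.¬Any⇒All¬ es e∉ ∷ u) (He ∷ Hes)
      (subst (size ℕ.<_) (sym (ℕ.+-suc n (length es))) lt)

  balanced-remove : ∀ {F u es} → Balanced F → Circuit u es → Unique es → In F es →
                    Balanced (setAll false es F)
  balanced-remove {es = es} balF (_ , _ , s≢t , a) u Fes S =
    trans (bal-setAll-false (ind S) u Fes) (cong₂ _-_ (balF S) (total-closed (ind S) a s≢t))

  -- The second circuit starts and ends in different colours, so in one of its two directions it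
  -- leaves `a` in a colour other than the last colour `t` of the first circuit.
  splice : ∀ {a es fs} → Circuit a es → Circuit a fs → ∃[ hs ] Circuit a hs × hs ↭ es ++ fs
  splice {es = es} {fs} (s , t , s≢t , a) (s′ , t′ , s′≢t′ , b) with t ≟ s′
  ... | no t≢s′  = es ++ fs , (s , t′ , s≢t′ , append a t≢s′ b) , ↭-refl
    where
    s≢t′ : s ≢ t′
    s≢t′ refl = s′≢t′ (trans (≢⇒≡op (t≢s′)) (sym (≢⇒≡op (s≢t ∘ sym))))
  ... | yes refl = es ++ reverse fs , (s , t , s≢t , append a s′≢t′ (arc-reverse b)) , ++⁺ˡ es (↭-reverse fs)


  -- If an edge of F leaves the visited vertices, it is taken as an arc from its new end to its
  -- visited end and closed up outside the circuit, which is still balanced; the result is spliced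
  -- in. If no edge leaves them, they form a cut, and connectivity makes them all vertices.
  spanning-circuit : ∀ {F} → Balanced F → Connected F → ∀ n {u es} → Circuit u es → Unique es → In F es →
                     size ℕ.< n ℕ.+ length es →
                     ∃[ v ] ∃[ fs ] Circuit v fs × Unique fs × (∀ x → Incident x fs)
  spanning-circuit balF conF zero c u Fes lt = ⊥-elim (ℕ.<⇒≱ lt (unique-length u))
  spanning-circuit {F} balF conF (suc n) {u} {es} c@(_ , _ , _ , arc) uq Fes lt with all? (λ x → incident? x es)
  ... | yes all = u , es , c , uq , all
  ... | no ¬all = go (any? λ e → (F e ≟ᵇ true) ×-dec ¬? (S (src e) ≟ᵇ S (tgt e)))
    where
    S : V → Bool
    S v = does (incident? v es)

    enlarge : ∀ {e a b} → F e ≡ true → Joins e b a → Incident a es → ¬ Incident b es →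
              ∃[ v ] ∃[ fs ] Circuit v fs × Unique fs × (∀ x → Incident x fs)
    enlarge {e} {a} {b} Fe j ia ¬ib
      with close (balanced-remove balF c uq Fes) (suc size) (single j refl) ([] ∷ [])
             (trans (setAll-∉ es e∉) Fe ∷ []) (ℕ.m≤m+n (suc size) 1)
         | rotate c ia
      where
      e∉ : e ∉ es
      e∉ e∈ = ¬ib (Any.map (λ { refl → joins-meets j }) e∈)
    ... | q , fs , b-arc , q≢t , ufs , Hfs | gs , cg , perm
      with splice cg (q , colour e , q≢t , b-arc)
    ... | hs , ch , hs↭ = spanning-circuit balF conF n ch
        (unique-resp-↭ (↭-sym hs↭) (Unique.++⁺ (unique-resp-↭ (↭-sym perm) uq) ufs disj))
        (All-resp-↭ (↭-sym hs↭) (All.++⁺ (All-resp-↭ (↭-sym perm) Fes) (All.map not-removed Hfs)))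
        bound
      where
      disj : ∀ {f} → ¬ (f ∈ gs × f ∈ fs)
      disj (f∈g , f∈f) = case trans (sym (All.lookup Hfs f∈f)) (setAll-∈ es (Any-resp-↭ perm f∈g)) of λ ()
      not-removed : ∀ {f} → setAll false es F f ≡ true → F f ≡ true
      not-removed {f} eq with Any.any? (f ≟_) es
      ... | yes f∈ = All.lookup Fes f∈
      ... | no f∉  = trans (sym (setAll-∉ es f∉)) eq
      positive : ∀ {u s fs v t} → Arc u s fs v t → 1 ℕ.≤ length fs
      positive (single _ _)   = ℕ.s≤s ℕ.z≤n
      positive (cons _ _ _ _) = ℕ.s≤s ℕ.z≤n
      bound : size ℕ.< n ℕ.+ length hs
      bound = ℕ.≤-trans lt (ℕ.≤-trans (ℕ.≤-reflexive (sym (ℕ.+-suc n (length es)))) (ℕ.+-monoʳ-≤ n longer))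
        where
        open ℕ.≤-Reasoning
        longer : suc (length es) ℕ.≤ length hs
        longer = begin
          1 ℕ.+ length es         ≤⟨ ℕ.+-monoˡ-≤ (length es) (positive b-arc) ⟩
          length fs ℕ.+ length es ≡⟨ ℕ.+-comm (length fs) (length es) ⟩
          length es ℕ.+ length fs ≡⟨ cong (ℕ._+ length fs) (↭-length perm) ⟨
          length gs ℕ.+ length fs ≡⟨ length-++ gs ⟨
          length (gs ++ fs)       ≡⟨ ↭-length hs↭ ⟨
          length hs               ∎

    go : Dec (∃[ e ] F e ≡ true × S (src e) ≢ S (tgt e)) →
         ∃[ v ] ∃[ fs ] Circuit v fs × Unique fs × (∀ x → Incident x fs)
    go (yes (e , Fe , S≢)) with incident? (src e) es | incident? (tgt e) es
    ... | yes i | yes i′ = ⊥-elim (S≢ refl)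
    ... | yes i | no ¬i  = enlarge Fe (joins-sym (ends e)) i ¬i
    ... | no ¬i | yes i  = enlarge Fe (ends e) i ¬i
    ... | no _  | no _   = ⊥-elim (S≢ refl)
    go (no none) with ¬∀⟶∃¬ _ _ (λ x → incident? x es) ¬all
    ... | x , ¬ix =
      case trans (sym (dec-true (incident? u es) (arc-incident-start arc)))
             (trans (conF u x S closed) (dec-false (incident? x es) ¬ix)) of λ ()
      where
      closed : Closed F S
      closed e Fe = decidable-stable (_ ≟ᵇ _) λ n → none (e , Fe , n)

  -- Passing between arcs and walks

  IsFirst IsLast : ∀ {u v} → Walk u v → Colour → Set
  IsFirst w s = ∃[ e ] FirstEdge w e × colour e ≡ s
  IsLast  w t = ∃[ e ] LastEdge w e × colour e ≡ t

  record Realises {u v} (s : Colour) (es : List E) (t : Colour) (w : Walk u v) : Set where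
    field
      edges-≡     : edges w ≡ es
      alternating : Alternating w
      initial     : IsFirst w s
      final       : IsLast w t
      visits      : ∀ x → Incident x es → x ∈ vertices w

  arc⇒walk : ∀ {u s es v t} → Arc u s es v t → ∃ (Realises {u} {v} s es t)
  arc⇒walk {u} {v = v} (single {e = e} j c) = step e j nil , record
    { edges-≡ = refl ; alternating = [-] ; initial = e , refl , c ; final = e , refl , c ; visits = vis }
    where
    vis : ∀ x → Incident x (e ∷ []) → x ∈ u ∷ v ∷ []
    vis x (here m) with meets-end j m
    ... | inj₁ refl = here refl
    ... | inj₂ refl = there (here refl)
  arc⇒walk {u} (cons {v = v} {e = e} {es = es} j c n a) with arc⇒walk a
  ... | w , r = step e j w , record
    { edges-≡     = cong (e ∷_) R.edges-≡
    ; alternating = link (proj₁ (proj₂ R.initial))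
                         (λ eq → n (trans (sym c) (trans eq (proj₂ (proj₂ R.initial))))) R.alternating
    ; initial     = e , refl , c
    ; final       = let f , l , d = R.final in f , prepend {fs = edges w} l , d
    ; visits      = vis }
    where
    module R = Realises r
    link : ∀ {f fs} → head fs ≡ just f → colour e ≢ colour f →
           Linked (λ e f → colour e ≢ colour f) fs → Linked (λ e f → colour e ≢ colour f) (e ∷ fs)
    link {fs = f ∷ fs} refl n l = n ∷ l
    prepend : ∀ {f fs} → last fs ≡ just f → last (e ∷ fs) ≡ just f
    prepend {fs = f ∷ fs} l = l
    start : ∀ {x y} (w : Walk x y) → x ∈ vertices w
    start nil          = here refl
    start (step _ _ _) = here refl
    vis : ∀ x → Incident x (e ∷ es) → x ∈ u ∷ vertices w
    vis x (here m) with meets-end j m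
    ... | inj₁ refl = here refl
    ... | inj₂ refl = there (start w)
    vis x (there i) = there (R.visits x i)

  walk⇒arc : ∀ {u v} (w : Walk u v) {e f} → Alternating w → FirstEdge w e → LastEdge w f →
             Arc u (colour e) (edges w) v (colour f)
  walk⇒arc (step e j nil) _ refl refl = single j refl
  walk⇒arc (step e j w@(step _ _ _)) (n ∷ alt) refl l = cons j refl n (walk⇒arc w alt refl l)

  vertices-incident : ∀ {u v} (w : Walk u v) {e x} → FirstEdge w e → x ∈ vertices w → Incident x (edges w)
  vertices-incident (step e j w)              f (here refl)         = here (joins-meets j)
  vertices-incident (step e j nil)            f (there (here refl)) = here (joins-meets (joins-sym j))
  vertices-incident (step e j w@(step _ _ _)) f (there i)           = there (vertices-incident w refl i)

  spanning-trail : ∀ {w es} → Circuit w es → Unique es → (∀ x → Incident x es) → Supereulerian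
  spanning-trail (s , t , s≢t , a) u inc with arc⇒walk a
  ... | w , r = _ , w , subst Unique (sym R.edges-≡) u ,
    (R.alternating , let e , fe , ce = R.initial ; f , lf , cf = R.final in
      e , f , fe , lf , λ eq → s≢t (trans (sym ce) (trans eq cf))) ,
    λ x → R.visits x (inc x)
    where module R = Realises r

  euler-circuit : Supereulerian → ∃[ u ] ∃[ es ] Circuit u es × Unique es × (∀ x → Incident x es)
  euler-circuit (u , w , uq , (alt , e , f , fe , lf , n) , sp) =
    u , edges w , (_ , _ , n , walk⇒arc w alt fe lf) , uq , λ x → vertices-incident w fe (sp x)

  -- A spanning circuit started at `u` and divided at `v` gives both trails, the second half being
  -- run backwards.
  supereulerian⇒trailColourConnected : Supereulerian → TrailColourConnected
  supereulerian⇒trailColourConnected se {u} {v} u≢v with euler-circuit se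
  ... | _ , es , c , uq , inc with rotate c (inc u)
  ... | fs , (s , t , s≢t , a) , perm
    with split a (Any-resp-↭ (↭-sym perm) (inc v))
  ... | at-start eq = ⊥-elim (u≢v (sym eq))
  ... | at-end eq   = ⊥-elim (u≢v (sym eq))
  ... | inside es₁ es₂ refl r≢r′ a₁ a₂
    with unique-++⁻ es₁ (unique-resp-↭ (↭-sym perm) uq) | arc⇒walk a₁ | arc⇒walk (arc-reverse a₂)
  ... | u₁ , u₂ | w₁ , R₁ | w₂ , R₂ =
    w₁ , w₂ , subst Unique (sym X.edges-≡) u₁ , X.alternating ,
    subst Unique (sym Y.edges-≡) (unique-resp-↭ (↭-sym (↭-reverse es₂)) u₂) , Y.alternating ,
    (let e , fe , ce = X.initial ; f , ff , cf = Y.initial in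
       e , f , fe , ff , λ eq → s≢t (trans (sym ce) (trans eq cf))) ,
    (let e , fe , ce = X.final ; f , ff , cf = Y.final in
       e , f , fe , ff , λ eq → r≢r′ (trans (sym ce) (trans eq cf)))
    where
    module X = Realises R₁
    module Y = Realises R₂

whole : ∀ G → InducedSubgraph G G
whole G = record
  { vertex = id ; edge = id ; vertex-injective = id ; edge-injective = id
  ; edge-joins = Trails.ends G ; edge-colour = λ _ → refl ; edge-full = λ {e} _ → e , refl }

supereulerian⇒factor : ∀ {G} → Graph.Supereulerian G → EulerianFactor G
supereulerian⇒factor {G} se = record
  { k = 1 ; k≥1 = ℕ.s≤s ℕ.z≤n ; part = λ _ → G ; induced = λ _ → whole G
  ; disjoint = λ { {zero} {zero} _ → refl }
  ; covering = λ x → zero , x , refl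
  ; supereulerian = λ _ → se }

odd-1 : ¬ Even 1ℤ
odd-1 (ℤ.+ suc n , eq) = case trans (sym (ℕ.+-suc n n)) (cong ℕ.pred (sym (ℤ.+-injective eq))) of λ ()

odd--1 : ¬ Even -1ℤ
odd--1 (ℤ.+ n , ())
odd--1 (ℤ.-[1+ n ] , ())

-- Exchanges of edges and the uses of balance

module Improvements (G : Graph) (F : Graph.E G → Bool) (balF : Trails.Balanced G F) where
  open Graph G
  open Trails G
  open Circuits G

  -- Components are joined and none is split, so their number drops; the number of edges may change
  -- either way.
  Improvement : Set
  Improvement = ∃[ F′ ] Balanced F′ × (∀ e → F e ≡ true → Conn F′ (src e) (tgt e)) ×
                        ∃[ e ] ¬ Conn F (src e) (tgt e) × Conn F′ (src e) (tgt e)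

  -- Equal totals preserve balance. A cut that no edge of the new set crosses is crossed by no added
  -- and no kept edge; the last condition on cuts then says that the removed edges do not cross it
  -- either, so nothing gets separated.
  exchange : ∀ rm ad → In F rm → All (λ e → F e ≡ false) ad → Unique rm → Unique ad →
             (∀ g → total g ad ≡ total g rm) →
             (∀ S → All (ClosedAt S) ad → (∀ e → F e ≡ true → e ∉ rm → ClosedAt S e) → All (ClosedAt S) rm) →
             ∀ {e} → e ∈ ad → ¬ Conn F (src e) (tgt e) → Improvement
  exchange rm ad Frm Fad urm uad tot rejoin {e} e∈ ¬c = F′ , bal′ , mono , e , ¬c , new-conn e∈
    where
    F₁ = setAll false rm F
    F′ = setAll true ad F₁
    F₁-false : ∀ {e} → F e ≡ false → F₁ e ≡ false
    F₁-false {e} Fe with Any.any? (e ≟_) rm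
    ... | yes e∈ = setAll-∈ rm e∈
    ... | no e∉  = trans (setAll-∉ rm e∉) Fe
    cancel : ∀ a → (0ℤ - a) + a ≡ 0ℤ
    cancel = solve-∀
    bal′ : Balanced F′
    bal′ S = trans (bal-setAll-true (ind S) uad (All.map F₁-false Fad))
      (trans (cong₂ _+_ (trans (bal-setAll-false (ind S) urm Frm) (cong (_- total (ind S) rm) (balF S))) (tot (ind S)))
             (cancel (total (ind S) rm)))
    kept : ∀ S → Closed F′ S → ∀ e → F e ≡ true → e ∉ rm → ClosedAt S e
    kept S cl e Fe e∉ with Any.any? (e ≟_) ad
    ... | yes e∈ad = cl e (setAll-∈ ad e∈ad)
    ... | no e∉ad  = cl e (trans (setAll-∉ ad e∉ad) (trans (setAll-∉ rm e∉) Fe))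
    new-conn : ∀ {e} → e ∈ ad → Conn F′ (src e) (tgt e)
    new-conn e∈ S cl = cl _ (setAll-∈ ad e∈)
    mono : ∀ e → F e ≡ true → Conn F′ (src e) (tgt e)
    mono e Fe S cl with Any.any? (e ≟_) rm
    ... | no e∉  = kept S cl e Fe e∉
    ... | yes e∈ = All.lookup (rejoin S (All.tabulate λ e∈ad → cl _ (setAll-∈ ad e∈ad)) (kept S cl)) e∈

  -- Deleting one edge from a balanced set disconnects nothing: the edges
  -- leaving a side of a cut are even in number.
  bridgeless : ∀ {e u x K S} → F e ≡ true → Joins e u x → Closed F K → K u ≡ true →
               (∀ f → F f ≡ true → f ≢ e → K (src f) ≡ true → ClosedAt S f) → S u ≡ S x
  bridgeless {e} {u} {x} {K} {S} Fe j clK Ku keep = decidable-stable (_ ≟ᵇ _) λ S≢ →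
    odd-value (colour e) (S u) (S x) S≢ (subst Even value (sum-even even))
    where
    -- `keep` controls only the edges on the true side of `K`, so the cut is restricted to that
    -- side. This allows a second edge to be missing on the other side.
    T : V → Bool
    T v = K v ∧ S v
    H = setAll false (e ∷ []) F
    Kx : K x ≡ true
    Kx = trans (sym (closedAt⇒≡ K j (clK e Fe))) Ku
    value : bal H (ind T) ≡ 0ℤ - (sgn (colour e) * (ind S u + ind S x) + 0ℤ)
    value = trans (bal-setAll-false (ind T) ([] ∷ []) (Fe ∷ []))
      (cong₂ (λ a b → a - (b + 0ℤ)) (balF T)
        (trans (Δ-joins (ind T) j refl)
          (cong₂ (λ a b → sgn (colour e) * ((if a ∧ S u then 1ℤ else 0ℤ) + (if b ∧ S x then 1ℤ else 0ℤ))) Ku Kx)))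
    odd-value : ∀ c a b → a ≢ b →
      ¬ Even (0ℤ - (sgn c * ((if a then 1ℤ else 0ℤ) + (if b then 1ℤ else 0ℤ)) + 0ℤ))
    odd-value c          true  true  n = ⊥-elim (n refl)
    odd-value c          false false n = ⊥-elim (n refl)
    odd-value zero       true  false n = odd--1
    odd-value zero       false true  n = odd--1
    odd-value (suc zero) true  false n = odd-1
    odd-value (suc zero) false true  n = odd-1
    double : ∀ s a → s * (a + a) ≡ s * a + s * a
    double = solve-∀
    balanced-end : ∀ f → F f ≡ true → f ≢ e → T (src f) ≡ T (tgt f)
    balanced-end f Ff f≢e with K (src f) in eq | K (tgt f) in eq′
    ... | true  | true  = keep f Ff f≢e eq
    ... | false | false = refl
    ... | true  | false = case trans (sym eq) (trans (clK f Ff) eq′) of λ ()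
    ... | false | true  = case trans (sym eq) (trans (clK f Ff) eq′) of λ ()
    even : ∀ f → Even (weigh H (ind T) f)
    even f with f ≟ e
    ... | yes _ = 0ℤ , refl
    ... | no f≢e with F f in Ff
    ...   | false = 0ℤ , refl
    ...   | true rewrite sym (balanced-end f Ff f≢e) =
      sgn (colour f) * ind T (src f) , double (sgn (colour f)) (ind T (src f))

  -- With weight ∓1 on the two classes and 0 elsewhere every edge of F contributes
  -- at least 0 to a sum that vanishes, hence exactly 0.
  alternating-classes :
    ∀ {T : Colour → V → Set} → (∀ s v → Dec (T s v)) → (∀ {s v} → T s v → T (op s) v → ⊥) →
    (∀ {s u v e} → T s u → F e ≡ true → Joins e u v → colour e ≡ s → T (op s) v) →
    ∀ {s u v e} → T s u → F e ≡ true → Joins e u v → T (op s) v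
  alternating-classes {T} T? disj next {s} {u} {v} {e} Tsu Fe j with ≡⊎≡op s (colour e)
  ... | inj₁ c = next Tsu Fe j c
  ... | inj₂ c = conclude
    where
    P : Colour → V → Bool
    P t w = does (T? t w)
    g : V → ℤ
    g w = 1ℤ * ind (P (suc zero)) w + -1ℤ * ind (P zero) w

    g-at : Colour → Bool → Bool → ℤ
    g-at t b₁ b₀ = sgn t * (1ℤ * (if b₁ then 1ℤ else 0ℤ) + -1ℤ * (if b₀ then 1ℤ else 0ℤ))

    -- Seen from an edge of colour `t`, class `t` counts -1 and class `op t` counts 1. By `next`, an
    -- end that counts -1 is always offset by one that counts 1.
    data Value (t : Colour) (w : V) : Set where
      below : T t w → sgn t * g w ≡ -1ℤ → Value t w
      above : T (op t) w → sgn t * g w ≡ 1ℤ → Value t w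
      level : ¬ T t w → ¬ T (op t) w → sgn t * g w ≡ 0ℤ → Value t w

    value : ∀ t w → Value t w
    value t w with T? zero w in eq | T? (suc zero) w in eq′
    value t w          | yes p | yes q = ⊥-elim (disj p q)
    value zero w       | yes p | no q  = below p (cong₂ (g-at zero) (cong does eq′) (cong does eq))
    value zero w       | no p  | yes q = above q (cong₂ (g-at zero) (cong does eq′) (cong does eq))
    value (suc zero) w | yes p | no q  = above p (cong₂ (g-at (suc zero)) (cong does eq′) (cong does eq))
    value (suc zero) w | no p  | yes q = below q (cong₂ (g-at (suc zero)) (cong does eq′) (cong does eq))
    value zero w       | no p  | no q  = level p q (cong₂ (g-at zero) (cong does eq′) (cong does eq))
    value (suc zero) w | no p  | no q  = level q p (cong₂ (g-at (suc zero)) (cong does eq′) (cong does eq))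

    above-value : ∀ {t w} → T (op t) w → sgn t * g w ≡ 1ℤ
    above-value {t} {w} q with value t w
    ... | below p _   = ⊥-elim (disj p q)
    ... | above _ eq  = eq
    ... | level _ n _ = ⊥-elim (n q)

    sum-value : ∀ {t a b f} → F f ≡ true → Joins f a b → colour f ≡ t → 0ℤ ≤ sgn t * g a + sgn t * g b
    sum-value {t} {a} {b} Ff jf cf with value t a | value t b
    ... | below p eq   | _            rewrite eq | above-value {t} (next p Ff jf cf) = ℤ.+≤+ ℕ.z≤n
    ... | _            | below q eq   rewrite eq | above-value {t} (next q Ff (joins-sym jf) cf) = ℤ.+≤+ ℕ.z≤n
    ... | above _ eq   | above _ eq′   rewrite eq | eq′ = ℤ.+≤+ ℕ.z≤n
    ... | above _ eq   | level _ _ eq′ rewrite eq | eq′ = ℤ.+≤+ ℕ.z≤n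
    ... | level _ _ eq | above _ eq′   rewrite eq | eq′ = ℤ.+≤+ ℕ.z≤n
    ... | level _ _ eq | level _ _ eq′ rewrite eq | eq′ = ℤ.+≤+ ℕ.z≤n

    nonneg : ∀ f → 0ℤ ≤ weigh F g f
    nonneg f with F f in Ff
    ... | false = ℤ.≤-refl
    ... | true  = subst (0ℤ ≤_) (sym (ℤ.*-distribˡ-+ (sgn (colour f)) (g (src f)) (g (tgt f))))
                        (sum-value Ff (ends f) refl)

    at-e : sgn (op s) * g u + sgn (op s) * g v ≡ 0ℤ
    at-e = begin
      sgn (op s) * g u + sgn (op s) * g v ≡⟨ ℤ.*-distribˡ-+ (sgn (op s)) (g u) (g v) ⟨
      sgn (op s) * (g u + g v)            ≡⟨ Δ-joins g j c ⟨
      Δ g e                               ≡⟨ cong (λ b → if b then Δ g e else 0ℤ) Fe ⟨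
      weigh F g e                         ≡⟨ sum-nonneg-zero nonneg (balanced-linear balF 1ℤ -1ℤ (P (suc zero)) (P zero)) e ⟩
      0ℤ                                  ∎
      where open ≡-Reasoning

    -- For the colour `op s` of `e` the vertex `u` counts 1; as the edge contributes 0, `v` counts
    -- -1.
    conclude : T (op s) v
    conclude with value (op s) v | trans (cong (_+ sgn (op s) * g v)
                    (sym (above-value {op s} (subst (λ t → T t u) (sym (op-op s)) Tsu)))) at-e
    ... | below p _    | _  = p
    ... | above _ eq   | eq′ rewrite eq = case eq′ of λ ()
    ... | level _ _ eq | eq′ rewrite eq = case eq′ of λ ()

-- Adjacency and links when no improvement exists

module Unimprovable
  (G : Graph) (F : Graph.E G → Bool) (balF : Trails.Balanced G F)
  (nonIsolated : ∀ x → ∃[ y ] x ≢ y × Trails.Conn G F x y)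
  (unimprovable : ¬ Improvements.Improvement G F balF)
  {m : ℕ} (class : Graph.V G → Fin m)
  (twin : ∀ {e x y u} → class x ≡ class y → Graph.Joins G e x u →
          ∃[ f ] Graph.Joins G f y u × Graph.colour G f ≡ Graph.colour G e)
  (mclosed : ∀ {u x z e f} → Graph.Joins G e u x → Graph.Joins G f u z →
             Graph.colour G e ≡ Graph.colour G f → class x ≢ class z → ∃[ g ] Graph.Joins G g x z)
  where
  open Graph G
  open Trails G
  open Circuits G
  open Improvements G F balF

  infix 4 _~_ _#_

  -- A record, because `Conn F u v` unfolds to a function type from which `u` and `v` cannot be
  -- inferred.
  record _~_ (u v : V) : Set where
    constructor conn
    field unconn : Conn F u v
  open _~_

  _#_ : V → V → Set
  u # v = ¬ (u ~ v)

  _~?_ : ∀ u v → Dec (u ~ v)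
  u ~? v = map′ conn unconn (conn? F u v)

  ~-refl : ∀ {u} → u ~ u
  ~-refl = conn λ _ _ → refl

  ~-sym : ∀ {u v} → u ~ v → v ~ u
  ~-sym (conn c) = conn λ S cl → sym (c S cl)

  ~-trans : ∀ {u v w} → u ~ v → v ~ w → u ~ w
  ~-trans (conn c) (conn d) = conn λ S cl → trans (c S cl) (d S cl)

  #-sym : ∀ {u v} → u # v → v # u
  #-sym n = n ∘ ~-sym

  #-moveˡ : ∀ {u v w} → u ~ w → u # v → w # v
  #-moveˡ c n d = n (~-trans c d)

  #-moveʳ : ∀ {u v w} → v ~ w → u # v → u # w
  #-moveʳ c n d = n (~-trans d (~-sym c))

  ~-induct : ∀ {P : V → Set} → (∀ v → Dec (P v)) → (∀ {e u v} → F e ≡ true → Joins e u v → P u → P v) →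
             ∀ {u v} → u ~ v → P u → P v
  ~-induct P? next (conn c) = conn-induct P? next c

  Adj Link : Colour → V → V → Set
  Adj  s u v = ∃[ e ] Joins e u v × colour e ≡ s
  Link s u v = ∃[ e ] F e ≡ true × Joins e u v × colour e ≡ s

  Adj? : ∀ s u v → Dec (Adj s u v)
  Adj? s u v = any? λ e → Joins? e u v ×-dec (colour e ≟ s)

  Link? : ∀ s u v → Dec (Link s u v)
  Link? s u v = any? λ e → (F e ≟ᵇ true) ×-dec Joins? e u v ×-dec (colour e ≟ s)

  adj-sym : ∀ {s u v} → Adj s u v → Adj s v u
  adj-sym (e , j , c) = e , joins-sym j , c

  link-sym : ∀ {s u v} → Link s u v → Link s v u
  link-sym (e , Fe , j , c) = e , Fe , joins-sym j , c

  link⇒adj : ∀ {s u v} → Link s u v → Adj s u v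
  link⇒adj (e , _ , j , c) = e , j , c

  link⇒~ : ∀ {s u v} → Link s u v → u ~ v
  link⇒~ (e , Fe , j , _) = conn (edge-conn Fe j)

  adj-op-op : ∀ {s u v} → Adj (op (op s)) u v → Adj s u v
  adj-op-op {s} = subst (λ t → Adj t _ _) (op-op s)

  alternating-links :
    ∀ {T : Colour → V → Set} → (∀ s v → Dec (T s v)) → (∀ {s v} → T s v → T (op s) v → ⊥) →
    (∀ {s u v} → T s u → Link s u v → T (op s) v) →
    ∀ {s t u v} → T s u → Link t u v → T (op s) v
  alternating-links T? disj next p (e , Fe , j , _) =
    alternating-classes T? disj (λ q Fe j c → next q (_ , Fe , j , c)) p Fe j

  some-edge : ∀ x → ∃[ t ] ∃[ y ] Link t x y
  some-edge x with any? (λ e → (F e ≟ᵇ true) ×-dec Meets? x e)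
  ... | yes (e , Fe , inj₁ m) = colour e , tgt e , e , Fe , inj₁ (m , refl) , refl
  ... | yes (e , Fe , inj₂ m) = colour e , src e , e , Fe , inj₂ (refl , m) , refl
  ... | no none with nonIsolated x
  ...   | y , x≢y , c = case trans (sym (dec-true (x ≟ x) refl)) (trans (c S closed) (dec-false (x ≟ y) x≢y)) of λ ()
    where
    S : V → Bool
    S v = does (x ≟ v)
    closed : Closed F S
    closed e Fe rewrite dec-false (x ≟ src e) (λ eq → none (e , Fe , inj₁ (sym eq)))
                      | dec-false (x ≟ tgt e) (λ eq → none (e , Fe , inj₂ (sym eq))) = refl

  -- Without such a link at `x`, the classes in which `x` alone has class `s` satisfy the hypothesis
  -- of `alternating-links` vacuously; any link at `x` would then lead into the empty class `op s`.
  link : ∀ s x → ∃[ y ] Link s x y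
  link s x with any? (Link? s x) | some-edge x
  ... | yes l   | _         = l
  ... | no none | t , y , l = ⊥-elim (op-≢ s (proj₁ (alternating-links {T = T} T? disj next (refl , refl) l)))
    where
    T : Colour → V → Set
    T r v = r ≡ s × v ≡ x
    T? : ∀ r v → Dec (T r v)
    T? r v = (r ≟ s) ×-dec (v ≟ x)
    disj : ∀ {r v} → T r v → T (op r) v → ⊥
    disj (refl , _) (eq , _) = op-≢ s eq
    next : ∀ {r u v} → T r u → Link r u v → T (op r) v
    next (refl , refl) l = ⊥-elim (none (_ , l))

  -- Forbidden configurations between components

  cross-edge : ∀ {e u v} → u # v → Joins e u v → F e ≡ false
  cross-edge {e} n j with F e in Fe
  ... | true  = ⊥-elim (n (conn (edge-conn Fe j)))
  ... | false = refl

  cross-ends : ∀ {e u v} → u # v → Joins e u v → ¬ Conn F (src e) (tgt e)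
  cross-ends n (inj₁ (refl , refl)) c = n (conn c)
  cross-ends n (inj₂ (refl , refl)) c = n (~-sym (conn c))

  -- A cycle of edges that cross a cut of F and alternate in colour can be added to F.
  module CrossingCycle
    {K : V → Bool} (clK : Closed F K) (s : Colour) {A : V → Set}
    (next : ∀ {x} → A x → ∃[ y ] A y × Adj (if K x then s else op s) x y × K y ≡ not (K x)) where

    κ : Bool → Colour
    κ b = if b then s else op s

    κ-not-≢ : ∀ b → κ (not b) ≢ κ b
    κ-not-≢ true  = op-≢ s
    κ-not-≢ false = op-≢ s ∘ sym

    data Chain (x : V) : V → List E → Set where
      start  : Chain x x []
      extend : ∀ {y z e es} → Chain x y es → Joins e y z → colour e ≡ κ (K y) → K z ≡ not (K y) →
               Chain x z (e ∷ es)

    crossing : ∀ {x y es} → Chain x y es → All (λ e → ¬ Conn F (src e) (tgt e)) es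
    crossing start = []
    crossing (extend ch j c k) = cross-ends (λ (conn d) → flip-≢ k (d K clK)) j ∷ crossing ch
      where
      flip-≢ : ∀ {a b} → b ≡ not a → a ≢ b
      flip-≢ {true}  refl ()
      flip-≢ {false} refl ()

    -- A crossing edge has colour `s` in one direction and `op s` in the other, so its colour fixes
    -- the direction in which it was used before. The chain since that use, read backwards, is the
    -- arc; when `a` is `y`, it is closed and alternating.
    cutoff : ∀ {x a es e y z} → Chain x a es → e ∈ es → Joins e y z → colour e ≡ κ (K y) →
             ∃[ ps ] ∃[ qs ] es ≡ ps ++ qs × Arc a (κ (not (K a))) ps y (κ (K y))
    cutoff (extend {y = b} {e = e} {es} ch j c k) (here refl) j′ c′ with joins-end j j′
    ... | inj₁ (refl , refl) = e ∷ [] , es , refl ,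
      subst (λ t → Arc _ t _ _ _) (cong κ (sym (trans (cong not k) (not-involutive _)))) (single (joins-sym j) c)
    ... | inj₂ (refl , refl) = ⊥-elim (κ-not-≢ (K b) (trans (cong κ (sym k)) (trans (sym c′) c)))
    cutoff (extend {y = b} {e = e} ch j c k) (there i) j′ c′ with cutoff ch i j′ c′
    ... | ps , qs , refl , a = e ∷ ps , qs , refl ,
      cons (joins-sym j) (trans c (cong κ (sym (trans (cong not k) (not-involutive _)))))
        (λ eq → κ-not-≢ (K b) (trans (sym eq) (cong κ (trans (cong not k) (not-involutive _))))) a

    loop : ∀ n {x y es} → Chain x y es → Unique es → A y → size ℕ.< n ℕ.+ length es → ⊥
    loop zero    ch u ay lt = ℕ.<⇒≱ lt (unique-length u)
    loop (suc n) {es = es} ch u ay lt with next ay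
    ... | z , az , (e , j , c) , k with Any.any? (e ≟_) es
    ... | no e∉ = loop n (extend ch j c k) (All.¬Any⇒All¬ es e∉ ∷ u) az
                    (subst (size ℕ.<_) (sym (ℕ.+-suc n (length es))) lt)
    ... | yes e∈ with cutoff ch e∈ j c
    ...   | ps , qs , refl , a = unimprovable (exchange [] ps [] (All.map nonF cr) [] (proj₁ (unique-++⁻ ps u))
              (λ g → total-closed g a (κ-not-≢ _)) (λ _ _ _ → []) (proj₂ (nonempty a)) (All.lookup cr (proj₂ (nonempty a))))
      where
      cr : All (λ e → ¬ Conn F (src e) (tgt e)) ps
      cr = All.++⁻ˡ ps (crossing ch)
      nonF : ∀ {e} → ¬ Conn F (src e) (tgt e) → F e ≡ false
      nonF {e} n = cross-edge (n ∘ unconn) (ends e)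
      nonempty : ∀ {u r fs v t} → Arc u r fs v t → ∃[ f ] f ∈ fs
      nonempty (single _ _)   = _ , here refl
      nonempty (cons _ _ _ _) = _ , here refl

    no-crossing-cycle : ∀ {x} → A x → ⊥
    no-crossing-cycle ax = loop (suc size) start [] ax (ℕ.m≤m+n (suc size) 0)

  -- Parallel edges of different colours form a closed alternating trail of length two.
  one-colour : ∀ {s u v} → u # v → Adj s u v → Adj (op s) u v → ⊥
  one-colour {s} {u} {v} n a b with cut (n ∘ conn)
  ... | K , clK , Ku , Kv = CrossingCycle.no-crossing-cycle clK s {A = A} next (inj₁ refl)
    where
    A : V → Set
    A x = x ≡ u ⊎ x ≡ v
    next : ∀ {x} → A x → ∃[ y ] A y × Adj (if K x then s else op s) x y × K y ≡ not (K x)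
    next (inj₁ refl) rewrite Ku = v , inj₂ refl , a , Kv
    next (inj₂ refl) rewrite Kv = u , inj₁ refl , adj-sym b , Ku

  -- The four vertices need not be distinct: `CrossingCycle` finds a closed trail in any endless
  -- walk of this kind.
  no-4-cycle : ∀ {s u v u′ v′} → u ~ u′ → v ~ v′ → u # v →
               Adj s u v → Adj (op s) v u′ → Adj s u′ v′ → Adj (op s) v′ u → ⊥
  no-4-cycle {s} {u} {v} {u′} {v′} (conn c) (conn d) n a₁ a₂ a₃ a₄ with cut (n ∘ conn)
  ... | K , clK , Ku , Kv = CrossingCycle.no-crossing-cycle clK s {A = A} next (inj₁ refl)
    where
    Ku′ : K u′ ≡ true
    Ku′ = trans (sym (c K clK)) Ku
    Kv′ : K v′ ≡ false
    Kv′ = trans (sym (d K clK)) Kv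
    A : V → Set
    A x = x ≡ u ⊎ x ≡ v ⊎ x ≡ u′ ⊎ x ≡ v′
    next : ∀ {x} → A x → ∃[ y ] A y × Adj (if K x then s else op s) x y × K y ≡ not (K x)
    next (inj₁ refl)               rewrite Ku  = v  , inj₂ (inj₁ refl) , a₁ , Kv
    next (inj₂ (inj₁ refl))        rewrite Kv  = u′ , inj₂ (inj₂ (inj₁ refl)) , a₂ , Ku′
    next (inj₂ (inj₂ (inj₁ refl))) rewrite Ku′ = v′ , inj₂ (inj₂ (inj₂ refl)) , a₃ , Kv′
    next (inj₂ (inj₂ (inj₂ refl))) rewrite Kv′ = u  , inj₁ refl , a₄ , Ku

  other-colour : ∀ {e f s} → colour e ≡ s → colour f ≡ op s → e ≢ f
  other-colour {s = s} c d refl = op-≢ s (trans (sym d) c)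

  other-end : ∀ {e f v u x} → u ≢ x → Joins e v u → Joins f v x → e ≢ f
  other-end n j k refl with joins-end j k
  ... | inj₁ (_ , refl)    = n refl
  ... | inj₂ (refl , refl) = n refl

  off-end : ∀ {e f u v x y} → x ≢ u → x ≢ v → Joins e u v → Joins f x y → e ≢ f
  off-end n m j k refl with joins-end j k
  ... | inj₁ (eq , _) = n eq
  ... | inj₂ (eq , _) = m eq

  #⇒≢ : ∀ {u v} → u # v → u ≢ v
  #⇒≢ n refl = n ~-refl

  -- Replacing `ux` and `vy` by `uv` and `xy` changes no degree. Parity keeps `u` and `x` together
  -- after the loss of `ux`, and the new edges then connect `v` to `y` through them.
  no-swap : ∀ {s u v x y} → u # v → Link s u x → Link s v y → Adj s u v → Adj s x y → ⊥
  no-swap {s} {u} {v} {x} {y} n l@(e , Fe , je , ce) l′@(f , Ff , jf , cf) (a , ja , ca) (b , jb , cb) =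
    unimprovable (exchange (e ∷ f ∷ []) (a ∷ b ∷ []) (Fe ∷ Ff ∷ [])
      (cross-edge n ja ∷ cross-edge x#y jb ∷ [])
      ((off-end (#⇒≢ (#-sym n)) (#⇒≢ (#-sym x#v)) je jf ∷ []) ∷ [] ∷ [])
      ((off-end (joins-≢ je ∘ sym) (#⇒≢ x#v) ja jb ∷ []) ∷ [] ∷ [])
      tot rejoin (here refl) (cross-ends n ja))
    where
    x#v = #-moveˡ (link⇒~ l) n
    x#y = #-moveʳ (link⇒~ l′) x#v
    tot : ∀ g → total g (a ∷ b ∷ []) ≡ total g (e ∷ f ∷ [])
    tot g rewrite Δ-joins g ja ca | Δ-joins g jb cb | Δ-joins g je ce | Δ-joins g jf cf =
      lemma (sgn s) (g u) (g v) (g x) (g y)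
      where
      lemma : ∀ s u v x y → s * (u + v) + (s * (x + y) + 0ℤ) ≡ s * (u + x) + (s * (v + y) + 0ℤ)
      lemma = solve-∀
    rejoin : ∀ S → All (ClosedAt S) (a ∷ b ∷ []) →
             (∀ h → F h ≡ true → h ∉ e ∷ f ∷ [] → ClosedAt S h) → All (ClosedAt S) (e ∷ f ∷ [])
    rejoin S (Sa ∷ Sb ∷ []) keep with cut (n ∘ conn)
    ... | K , clK , Ku , Kv = ≡⇒closedAt S je ux ∷ ≡⇒closedAt S jf vy ∷ []
      where
      Kf : K (src f) ≡ false
      Kf with joins-end jf (ends f)
      ... | inj₁ (eq , _) = trans (cong K eq) Kv
      ... | inj₂ (eq , _) = trans (cong K eq) (trans (sym (closedAt⇒≡ K jf (clK f Ff))) Kv)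
      ux : S u ≡ S x
      -- The other removed edge `f` lies on the far side of `K`, where `bridgeless` asks for
      -- nothing.
      ux = bridgeless {K = K} {S} Fe je clK Ku λ h Fh h≢e Kh → keep h Fh
        λ { (here eq) → h≢e eq
          ; (there (here refl)) → case trans (sym Kh) Kf of λ () }
      vy : S v ≡ S y
      vy = trans (sym (closedAt⇒≡ S ja Sa)) (trans ux (closedAt⇒≡ S jb Sb))

  -- v is put into the edge ux and into the edge wz, which joins their components.
  no-insertion : ∀ {s u v w x z} → v # u → v # w → Link s u x → Link (op s) w z →
                 Adj s v u → Adj s v x → Adj (op s) v w → Adj (op s) v z → ⊥
  no-insertion {s} {u} {v} {w} {x} {z} n m l@(e , Fe , je , ce) l′@(f , Ff , jf , cf)
    (a , ja , ca) (b , jb , cb) (c , jc , cc) (d , jd , cd) =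
    unimprovable (exchange (e ∷ f ∷ []) (a ∷ b ∷ c ∷ d ∷ []) (Fe ∷ Ff ∷ [])
      (cross-edge n ja ∷ cross-edge (#-moveʳ (link⇒~ l) n) jb ∷
       cross-edge m jc ∷ cross-edge (#-moveʳ (link⇒~ l′) m) jd ∷ [])
      ((other-colour ce cf ∷ []) ∷ [] ∷ [])
      ((other-end (joins-≢ je) ja jb ∷ other-colour ca cc ∷ other-colour ca cd ∷ []) ∷
       (other-colour cb cc ∷ other-colour cb cd ∷ []) ∷ (other-end (joins-≢ jf) jc jd ∷ []) ∷ [] ∷ [])
      tot rejoin (here refl) (cross-ends n ja))
    where
    tot : ∀ g → total g (a ∷ b ∷ c ∷ d ∷ []) ≡ total g (e ∷ f ∷ [])
    tot g rewrite Δ-joins g ja ca | Δ-joins g jb cb | Δ-joins g jc cc | Δ-joins g jd cd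
                | Δ-joins g je ce | Δ-joins g jf cf | sgn-op s =
      lemma (sgn s) (g v) (g u) (g x) (g w) (g z)
      where
      lemma : ∀ s v u x w z →
        s * (v + u) + (s * (v + x) + ((- s) * (v + w) + ((- s) * (v + z) + 0ℤ))) ≡
        s * (u + x) + ((- s) * (w + z) + 0ℤ)
      lemma = solve-∀
    rejoin : ∀ S → All (ClosedAt S) (a ∷ b ∷ c ∷ d ∷ []) →
             (∀ h → F h ≡ true → h ∉ e ∷ f ∷ [] → ClosedAt S h) → All (ClosedAt S) (e ∷ f ∷ [])
    rejoin S (Sa ∷ Sb ∷ Sc ∷ Sd ∷ []) _ =
      ≡⇒closedAt S je (trans (sym (closedAt⇒≡ S ja Sa)) (closedAt⇒≡ S jb Sb)) ∷
      ≡⇒closedAt S jf (trans (sym (closedAt⇒≡ S jc Sc)) (closedAt⇒≡ S jd Sd)) ∷ []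

  -- The edge `ux` gives way to the path `u`, `w`, `w′`, `x` with colours `s`, `op s`, `s`. Each
  -- inner vertex gains one edge of either colour, and it does not matter whether `h` joins two
  -- components or stays in one.
  no-detour : ∀ {s u x w w′ h} → w # u → w′ # u → Link s u x →
              F h ≡ false → Joins h w w′ → colour h ≡ op s → Adj s w u → Adj s w′ x → ⊥
  no-detour {s} {u} {x} {w} {w′} {h} n m l@(e , Fe , je , ce) Fh jh ch (a , ja , ca) (b , jb , cb) =
    unimprovable (exchange (e ∷ []) (a ∷ h ∷ b ∷ []) (Fe ∷ [])
      (cross-edge n ja ∷ Fh ∷ cross-edge (#-moveʳ (link⇒~ l) m) jb ∷ [])
      ([] ∷ [])
      ((other-colour ca ch ∷ off-end w′≢w (#⇒≢ m) ja jb ∷ []) ∷ (other-colour cb ch ∘ sym ∷ []) ∷ [] ∷ [])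
      tot rejoin (here refl) (cross-ends n ja))
    where
    w′≢w : w′ ≢ w
    w′≢w = joins-≢ jh ∘ sym
    tot : ∀ g → total g (a ∷ h ∷ b ∷ []) ≡ total g (e ∷ [])
    tot g rewrite Δ-joins g ja ca | Δ-joins g jh ch | Δ-joins g jb cb | Δ-joins g je ce | sgn-op s =
      lemma (sgn s) (g w) (g u) (g w′) (g x)
      where
      lemma : ∀ s w u w′ x → s * (w + u) + ((- s) * (w + w′) + (s * (w′ + x) + 0ℤ)) ≡ s * (u + x) + 0ℤ
      lemma = solve-∀
    rejoin : ∀ S → All (ClosedAt S) (a ∷ h ∷ b ∷ []) →
             (∀ k → F k ≡ true → k ∉ e ∷ [] → ClosedAt S k) → All (ClosedAt S) (e ∷ [])
    rejoin S (Sa ∷ Sh ∷ Sb ∷ []) _ =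
      ≡⇒closedAt S je (trans (sym (closedAt⇒≡ S ja Sa)) (trans (closedAt⇒≡ S jh Sh) (closedAt⇒≡ S jb Sb))) ∷ []

  -- Domination between components

  -- For different classes this is M-closedness. Twins `x` and `z` in different components would
  -- have links `xa` and `zb`, which could be swapped for `xb` and `za`.
  adjacent : ∀ {s u x z} → x # z → Adj s u x → Adj s u z → Adj s x z ⊎ Adj (op s) x z
  adjacent {s} {u} {x} {z} n (e , je , ce) (f , jf , cf) with class x ≟ class z
  ... | no x≢z with mclosed je jf (trans ce (sym cf)) x≢z
  ...   | g , jg with ≡⊎≡op s (colour g)
  ...     | inj₁ c = inj₁ (g , jg , c)
  ...     | inj₂ c = inj₂ (g , jg , c)
  adjacent {s} {u} {x} {z} n _ _ | yes x≡z with link s x | link s z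
  ... | a , la | b , lb = ⊥-elim (no-swap (#-moveʳ (link⇒~ lb) n) la (link-sym lb)
          (copy (sym x≡z) lb) (adj-sym (copy x≡z la)))
    where
    copy : ∀ {p q r} → class p ≡ class q → Link s p r → Adj s q r
    copy eq (e , _ , j , c) with twin eq j
    ... | f , jf , cf = f , jf , trans cf c

  -- A good v can be inserted into the edge ux, changing the balance only at v,
  -- where colour s gains two edges.
  Good : Colour → V → V → Set
  Good s v c = ∃[ u ] ∃[ x ] c ~ u × Link s u x × Adj s v u × Adj s v x

  Good? : ∀ s v c → Dec (Good s v c)
  Good? s v c = any? λ u → any? λ x → (c ~? u) ×-dec Link? s u x ×-dec Adj? s v u ×-dec Adj? s v x

  AnyGood : V → V → Set
  AnyGood v c = ∃[ t ] Good t v c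

  AnyGood? : ∀ v c → Dec (AnyGood v c)
  AnyGood? v c = any? λ t → Good? t v c

  good-move : ∀ {s v c d} → c ~ d → Good s v c → Good s v d
  good-move c~d (u , x , c~u , rest) = u , x , ~-trans (~-sym c~d) c~u , rest

  -- For a link `pq` of colour `s`, M-closedness at `p` joins `w` to `q`, and colour `s` there would
  -- make `w` good. Links of the other colour are covered by counting.
  not-good-alternates : ∀ {w c} → w # c → ¬ AnyGood w c →
    ∀ {s t p q} → c ~ p → Adj s w p → Link t p q → Adj (op s) w q
  not-good-alternates {w} {c} n ng c~p a l = proj₂ (alternating-links {T = T} T? disj next (c~p , a) l)
    where
    T : Colour → V → Set
    T s p = c ~ p × Adj s w p
    T? : ∀ s p → Dec (T s p)
    T? s p = (c ~? p) ×-dec Adj? s w p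
    disj : ∀ {s p} → T s p → T (op s) p → ⊥
    disj (c~p , a) (_ , b) = one-colour (#-moveʳ c~p n) a b
    next : ∀ {s p q} → T s p → Link s p q → T (op s) q
    next (c~p , a) l with ~-trans c~p (link⇒~ l)
    ... | c~q with adjacent (#-moveʳ c~q n) (adj-sym a) (link⇒adj l)
    ...   | inj₁ b = ⊥-elim (ng (_ , _ , _ , c~p , l , a , b))
    ...   | inj₂ b = c~q , b

  -- Take links `ux` and `vy` of colour `s`. If neither side had a good vertex, `vx` would have
  -- colour `op s` and hence `xy` colour `s`, and the links could be swapped for `uv` and `xy`.
  contact : ∀ {s u v} → u # v → Adj s u v →
            (∃[ v′ ] v ~ v′ × AnyGood v′ u) ⊎ (∃[ u′ ] u ~ u′ × AnyGood u′ v)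
  contact {s} {u} {v} n a
    with any? (λ v′ → (v ~? v′) ×-dec AnyGood? v′ u) | any? (λ u′ → (u ~? u′) ×-dec AnyGood? u′ v)
  ... | yes p | _     = inj₁ p
  ... | no _  | yes q = inj₂ q
  ... | no n₁ | no n₂ with link s u | link s v
  ...   | x , l | y , l′ = ⊥-elim (no-swap n l l′ a
            (adj-op-op (not-good-alternates x#v (λ g → n₂ (x , link⇒~ l , g)) ~-refl (adj-sym vx) l′)))
    where
    x#v = #-moveˡ (link⇒~ l) n
    vx : Adj (op s) v x
    vx with adjacent (#-sym x#v) a (link⇒adj l)
    ... | inj₁ b = ⊥-elim (n₁ (v , ~-refl , s , u , x , ~-refl , l , adj-sym a , b))
    ... | inj₂ b = b

  good-link-adj : ∀ {s v u x y} → v # u → Adj s v u → Adj s v x → Link s u x → Link s v y →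
                  Adj (op s) y u
  good-link-adj n a b l l′ with adjacent (#-moveˡ (link⇒~ l′) n) (link⇒adj l′) a
  ... | inj₁ c = ⊥-elim (no-swap (#-moveʳ (link⇒~ l) n) l′ (link-sym l) b c)
  ... | inj₂ c = c

  -- By `no-swap`, `y` sees both ends of the link `ux` in colour `op s`. Its colours thus do not
  -- alternate along that link, so it is good; if it were so in colour `s` through `u′`, then `u`,
  -- `v`, `u′`, `y` would form a forbidden 4-cycle.
  good-switch₁ : ∀ {s v c y} → v # c → Good s v c → Link s v y → Good (op s) y c
  good-switch₁ {s} {v} {c} {y} n (u , x , c~u , l , a , b) l′ = result (AnyGood? y c)
    where
    y#c = #-moveˡ (link⇒~ l′) n
    v#u = #-moveʳ c~u n
    yu : Adj (op s) y u
    yu = good-link-adj v#u a b l l′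
    yx : Adj (op s) y x
    yx = good-link-adj (#-moveʳ (link⇒~ l) v#u) b a (link-sym l) l′
    result : Dec (AnyGood y c) → Good (op s) y c
    result (no ng) = ⊥-elim (one-colour (#-moveʳ (~-trans c~u (link⇒~ l)) y#c)
      (adj-op-op (not-good-alternates y#c ng c~u yu l)) yx)
    result (yes (t , g)) with ≡⊎≡op s t
    ... | inj₂ refl = g
    result (yes (_ , u′ , x′ , c~u′ , k , a′ , b′)) | inj₁ refl =
      ⊥-elim (no-4-cycle (~-trans (~-sym c~u) c~u′) (link⇒~ l′) (#-sym v#u) (adj-sym a)
        (good-link-adj (#-moveʳ c~u′ y#c) a′ b′ k (link-sym l′)) (adj-sym a′) yu)

  -- The excess of one insertion at `v` cancels that of the other. Since `c` and `d` may lie in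
  -- different components, the type of a good vertex depends on the vertex alone.
  one-type : ∀ {s v c d} → v # c → v # d → Good s v c → Good (op s) v d → ⊥
  one-type n m (u , x , c~u , l , a , b) (u′ , x′ , d~u′ , l′ , a′ , b′) =
    no-insertion (#-moveʳ c~u n) (#-moveʳ d~u′ m) l l′ a b a′ b′

  type-unique : ∀ {s t v c d} → v # c → v # d → Good s v c → Good t v d → s ≡ t
  type-unique {s} {t} n m g h with ≡⊎≡op s t
  ... | inj₁ eq   = sym eq
  ... | inj₂ refl = ⊥-elim (one-type n m g h)

  good-switch : ∀ {s t v c y} → v # c → Good s v c → Link t v y → Good (op s) y c
  good-switch {v = v} {c} n g l = proj₂ (alternating-links {T = T} T? disj next (~-refl , g) l)
    where
    T : Colour → V → Set
    T s w = v ~ w × Good s w c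
    T? : ∀ s w → Dec (T s w)
    T? s w = (v ~? w) ×-dec Good? s w c
    disj : ∀ {s w} → T s w → T (op s) w → ⊥
    disj (v~w , g) (_ , h) = one-type (#-moveˡ v~w n) (#-moveˡ v~w n) g h
    next : ∀ {s w w′} → T s w → Link s w w′ → T (op s) w′
    next (v~w , g) l = ~-trans v~w (link⇒~ l) , good-switch₁ (#-moveˡ v~w n) g l

  good-spread : ∀ {v w c} → v # c → AnyGood v c → v ~ w → AnyGood w c
  good-spread {v} {w} {c} n g v~w = proj₂ (~-induct {P = P} P? next v~w (~-refl , g))
    where
    P : V → Set
    P x = v ~ x × AnyGood x c
    P? : ∀ x → Dec (P x)
    P? x = (v ~? x) ×-dec AnyGood? x c
    next : ∀ {e x y} → F e ≡ true → Joins e x y → P x → P y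
    next Fe j (v~x , _ , h) = ~-trans v~x (conn (edge-conn Fe j)) ,
      _ , good-switch (#-moveˡ v~x n) h (_ , Fe , j , refl)

  of-type : ∀ {v c} → v # c → AnyGood v c → ∀ t → ∃[ w ] v ~ w × Good t w c
  of-type {v} n (s , g) t with ≡⊎≡op s t | link s v
  ... | inj₁ refl | _     = v , ~-refl , g
  ... | inj₂ refl | y , l = y , link⇒~ l , good-switch n g l

  -- Two components dominating each other have an infinite, hence a closed,
  -- alternating walk between them.
  no-mutual : ∀ {c d} → c # d → AnyGood c d → AnyGood d c → ⊥
  no-mutual {c} {d} n g h with cut (n ∘ conn)
  ... | K , clK , Kc , Kd with of-type n g zero
  ... | c₀ , c~c₀ , g₀ = CrossingCycle.no-crossing-cycle clK zero {A = A} next (inj₁ (c~c₀ , g₀))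
    where
    A : V → Set
    A x = (c ~ x × Good zero x d) ⊎ (d ~ x × Good (suc zero) x c)
    inC : ∀ {x} → c ~ x → K x ≡ true
    inC (conn p) = trans (sym (p K clK)) Kc
    inD : ∀ {x} → d ~ x → K x ≡ false
    inD (conn p) = trans (sym (p K clK)) Kd
    next : ∀ {x} → A x → ∃[ y ] A y × Adj (if K x then zero else suc zero) x y × K y ≡ not (K x)
    next {x} (inj₁ (c~x , v , y , d~v , l , a , b))
      rewrite inC c~x
      with good-spread (#-sym n) h d~v
    ... | suc zero , h′ = v , inj₂ (d~v , h′) , a , inD d~v
    ... | zero , h′     = y , inj₂ (d~y , good-switch (#-moveˡ d~v (#-sym n)) h′ l) , b , inD d~y
      where d~y = ~-trans d~v (link⇒~ l)
    next {x} (inj₂ (d~x , v , y , c~v , l , a , b))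
      rewrite inD d~x
      with good-spread n g c~v
    ... | zero , g′     = v , inj₁ (c~v , g′) , a , inC c~v
    ... | suc zero , g′ = y , inj₁ (c~y , good-switch (#-moveˡ c~v n) g′ l) , b , inC c~y
      where c~y = ~-trans c~v (link⇒~ l)

  -- A link `vy` of colour `op s` makes `y` good for `op s`, and M-closedness at `v` joins `w` to
  -- `y`. In colour `op s` this gives mutual domination; in colour `s` it gives a 4-cycle `v`, `w`,
  -- `y`, `m`.
  good-only : ∀ {s v c w} → v # c → Good s v c → c ~ w → Adj (op s) v w → ⊥
  good-only {s} {v} {c} {w} n g c~w a with link (op s) v
  ... | y , l with good-switch n g l
  ... | m , x , c~m , k , ym , yx =
    no-mutual (#-sym v#w)
      (op s , v , y , ~-refl , l , adj-sym a , wy (adjacent (#-moveʳ (link⇒~ l) (#-sym v#w)) a (link⇒adj l)))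
      (s , good-move c~w g)
    where
    v#w = #-moveʳ c~w n
    y#m = #-moveʳ c~m (n ∘ ~-trans (link⇒~ l))
    wy : Adj (op s) w y ⊎ Adj (op (op s)) w y → Adj (op s) w y
    wy (inj₁ b) = b
    wy (inj₂ b) = ⊥-elim (no-4-cycle (link⇒~ l) (~-trans (~-sym c~w) c~m) v#w a b ym
      (adj-sym (good-link-adj y#m ym yx k (link-sym l))))

  -- The dominated vertex `u` stays fixed while the dominating one moves along F: M-closedness at
  -- `q` joins `q′` to `u`, and `good-only` settles the colour.
  good-adj-spread : ∀ {v w c u} → v # c → c ~ u → v ~ w →
                    ∃[ t ] Good t v c × Adj t v u → ∃[ t ] Good t w c × Adj t w u
  good-adj-spread {v} {w} {c} {u} n c~u v~w p = proj₂ (~-induct {P = P} P? next v~w (~-refl , p))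
    where
    T : Colour → V → Set
    T t q = v ~ q × Good t q c × Adj t q u
    T? : ∀ t q → Dec (T t q)
    T? t q = (v ~? q) ×-dec Good? t q c ×-dec Adj? t q u
    disj : ∀ {t q} → T t q → T (op t) q → ⊥
    disj (v~q , g , _) (_ , h , _) = one-type (#-moveˡ v~q n) (#-moveˡ v~q n) g h
    switch : ∀ {t q q′} → T t q → Link t q q′ → T (op t) q′
    switch {t} {q} {q′} (v~q , g , a) l with ~-trans v~q (link⇒~ l)
    ... | v~q′ with #-moveˡ v~q′ n
    ...   | q′#c with good-switch (#-moveˡ v~q n) g l | adjacent (#-moveʳ c~u q′#c) (link⇒adj l) a
    ...     | h | inj₁ b = ⊥-elim (good-only q′#c h c~u (subst (λ r → Adj r q′ u) (sym (op-op t)) b))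
    ...     | h | inj₂ b = v~q′ , h , b
    P : V → Set
    P q = v ~ q × ∃[ t ] Good t q c × Adj t q u
    P? : ∀ q → Dec (P q)
    P? q = (v ~? q) ×-dec any? (λ t → Good? t q c ×-dec Adj? t q u)
    next : ∀ {e p q} → F e ≡ true → Joins e p q → P p → P q
    next Fe j (v~p , t , r) with alternating-links {T = T} T? disj switch (v~p , r) (_ , Fe , j , refl)
    ... | v~q , r′ = v~q , _ , r′

  -- M-closedness at `p` extends the adjacency of `v` from `p` to `q` only if `pq` has colour `s`.
  -- In general it is applied to a vertex `v′` in the component of `v` whose type is the colour of
  -- `pq`, and `good-adj-spread` leads from `v` to `v′` and back.
  good-all : ∀ {s v c w} → v # c → Good s v c → c ~ w → Adj s v w
  good-all {s} {v} {c} {w} n g@(u , x , c~u , _ , a , _) c~w =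
    proj₂ (~-induct {P = P} P? next (~-trans (~-sym c~u) c~w) (c~u , a))
    where
    P : V → Set
    P p = c ~ p × Adj s v p
    P? : ∀ p → Dec (P p)
    P? p = (c ~? p) ×-dec Adj? s v p
    at-v : ∀ {p} → c ~ p → ∃[ t ] Good t v c × Adj t v p → Adj s v p
    at-v c~p (t , h , b) with type-unique n n g h
    ... | refl = b
    next : ∀ {e p q} → F e ≡ true → Joins e p q → P p → P q
    next {e} {p} {q} Fe j (c~p , b) with of-type n (s , g) (colour e)
    ... | v′ , v~v′ , h with good-adj-spread n c~p v~v′ (s , g , b)
    ...   | t , h′ , b′ with type-unique (#-moveˡ v~v′ n) (#-moveˡ v~v′ n) h h′
    ...     | refl = c~q , at-v c~q (good-adj-spread v′#c c~q (~-sym v~v′) (colour e , h , v′q))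
      where
      v′#c = #-moveˡ v~v′ n
      c~q = ~-trans c~p (conn (edge-conn Fe j))
      v′q : Adj (colour e) v′ q
      v′q with adjacent (#-moveʳ c~q v′#c) (adj-sym b′) (e , j , refl)
      ... | inj₁ d = d
      ... | inj₂ d = ⊥-elim (good-only v′#c h c~q d)

  -- Alternating walks among the dominating components

  -- A walk enters the vertices of type s in colour s, so it goes on in colour op s.
  trapped-step : ∀ {s c p z} → p # c → Good s p c → Adj (op s) p z → z # c × Good (op s) z c
  trapped-step {s} {c} {p} {z} n g a@(h , jh , ch) with z ~? c
  ... | yes z~c = ⊥-elim (good-only n g (~-sym z~c) a)
  ... | no z#c with AnyGood? z c
  trapped-step {s} {c} {p} {z} n g a@(h , jh , ch) | no z#c | yes (t , g′) with ≡⊎≡op s t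
  ... | inj₂ refl = z#c , g′
  ... | inj₁ refl with F h in Fh
  ...   | true  = ⊥-elim (one-type z#c z#c g′ (good-switch n g (h , Fh , jh , ch)))
  ...   | false with link s c
  -- Here `p` and `z` have the same type, so the link `cx` can be rerouted through `p` and `z`.
  ...     | x , l = ⊥-elim (no-detour n z#c l Fh jh ch (good-all n g ~-refl) (good-all z#c g′ (link⇒~ l)))
  trapped-step {s} {c} {p} {z} n g a | no z#c | no ¬g with p ~? z
  ... | yes p~z = ⊥-elim (¬g (good-spread n (s , g) p~z))
  ... | no p#z with contact p#z a
  ...   | inj₂ (p′ , p~p′ , g′) with good-spread (#-moveˡ p~p′ p#z) g′ (~-sym p~p′)
  ...     | t , g″ with type-unique n p#z g g″
  ...       | refl = ⊥-elim (one-colour p#z (good-all p#z g″ ~-refl) a)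
  -- Now the component of `z` dominates that of `p`, and that of `p` dominates that of `c`. Through
  -- `p` some `z₁` is adjacent to `c`, so either `z` is good for `c` after all or domination is
  -- cyclic; in the latter case a link `ux` in the component of `c` can be rerouted through `p` and
  -- `z₂`.
  trapped-step {s} {c} {p} {z} n g a@(h , jh , ch) | no z#c | no ¬g | no p#z | inj₁ (z′ , z~z′ , g′)
    with of-type (#-moveˡ z~z′ (#-sym p#z)) g′ s | of-type (#-moveˡ z~z′ (#-sym p#z)) g′ (op s)
  ... | z₁ , z′~z₁ , g₁ | z₂ , z′~z₂ , g₂ =
    ⊥-elim (finish (adjacent z₁#c (adj-sym (good-all (#-moveˡ z~z₁ (#-sym p#z)) g₁ ~-refl)) (good-all n g ~-refl)))
    where
    z~z₁ = ~-trans z~z′ z′~z₁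
    z~z₂ = ~-trans z~z′ z′~z₂
    z₁#c = #-moveˡ z~z₁ z#c
    dominated : ∀ {t} → Adj t z₁ c → ⊥
    dominated b with contact z₁#c b
    ... | inj₂ (z₃ , z₁~z₃ , h) = ¬g (good-spread (#-moveˡ (~-trans z~z₁ z₁~z₃) z#c) h (~-sym (~-trans z~z₁ z₁~z₃)))
    ... | inj₁ (c′ , c~c′ , h) with of-type (#-moveˡ c~c′ (#-sym z₁#c)) h s
    ...   | x , c′~x , hx with link s x
    ...     | u , l = no-detour (#-moveʳ (~-trans c~x (link⇒~ l)) n) (#-moveˡ z~z₂ (#-moveʳ (~-trans c~x (link⇒~ l)) z#c))
                (link-sym l) (cross-edge p#z₂ jk) jk ck
                (good-all n g (~-trans c~x (link⇒~ l)))
                (adj-sym (good-all (#-moveˡ c~x (#-sym z₁#c)) hx (~-trans (~-sym z~z₁) z~z₂)))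
      where
      c~x = ~-trans c~c′ c′~x
      p#z₂ = #-moveʳ z~z₂ p#z
      pz₂ = adj-sym (good-all (#-moveˡ z~z₂ (#-sym p#z)) g₂ ~-refl)
      jk = proj₁ (proj₂ pz₂)
      ck = proj₂ (proj₂ pz₂)
    finish : Adj s z₁ c ⊎ Adj (op s) z₁ c → ⊥
    finish (inj₁ b) = dominated b
    finish (inj₂ b) = dominated b

  trapped : ∀ {s c p r es v t t′} → p # c → Good s p c → Arc p r es v t → r ≡ op s →
            v # c → Good t′ v c → t ≡ t′
  trapped n g (single j c) refl m h with trapped-step n g (_ , j , c)
  ... | v#c , g′ = type-unique v#c m g′ h
  trapped {s} n g (cons j c r≢s a) refl m h with trapped-step n g (_ , j , c)
  ... | q#c , g′ = trapped q#c g′ a (≢⇒≡op r≢s) m h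


  -- If an edge reached a dominating vertex in the colour opposite to its type, `trapped-step` along
  -- the reversed edge would make the preceding vertex dominating too. So the first such vertex is
  -- entered in the colour of its type, and `trapped` takes over.
  entering : ∀ {c p r es v t t′} → ¬ (p # c × AnyGood p c) → Arc p r es v t →
             v # c → Good t′ v c → t ≡ t′
  entering {t = t} {t′ = t′} out (single j c) m h with ≡⊎≡op t′ t
  ... | inj₁ eq   = eq
  ... | inj₂ refl with trapped-step m h (_ , joins-sym j , c)
  ...   | p#c , g = ⊥-elim (out (p#c , _ , g))
  entering {c = c₀} {r = r} out (cons {v = q} j c r≢s a) m h with ¬? (q ~? c₀) ×-dec AnyGood? q c₀
  ... | no out′ = entering out′ a m h
  ... | yes (q#c , τ , g) with ≡⊎≡op τ r
  ...   | inj₁ refl = trapped q#c g a (≢⇒≡op r≢s) m h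
  ...   | inj₂ refl with trapped-step q#c g (_ , joins-sym j , c)
  ...     | p#c , g′ = ⊥-elim (out (p#c , _ , g′))

  not-trailColourConnected : ∀ {c v} → v # c → AnyGood v c → ¬ TrailColourConnected
  not-trailColourConnected {c} {v} n (t , g) tcc with tcc {c} {v} (#⇒≢ n ∘ sym)
  ... | T₁ , T₂ , _ , alt₁ , _ , alt₂ , (_ , _ , first₁ , first₂ , _) , (_ , _ , last₁ , last₂ , differ) =
    differ (trans (entering out (walk⇒arc T₁ alt₁ first₁ last₁) n g)
                  (sym (entering out (walk⇒arc T₂ alt₂ first₂ last₂) n g)))
    where
    out : ¬ (c # c × AnyGood c c)
    out (c#c , _) = c#c ~-refl

  crossing-step : ∀ {K : V → Bool} {u v} → Walk u v → K u ≢ K v →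
                  ∃[ e ] ∃[ x ] ∃[ y ] Joins e x y × K x ≢ K y
  crossing-step nil n = ⊥-elim (n refl)
  crossing-step {K} {u} (step {v = x} e j w) n with K u ≟ᵇ K x
  ... | yes eq = crossing-step {K} w (n ∘ trans eq)
  ... | no ne  = e , u , x , j , ne

  trailColourConnected⇒connected : TrailColourConnected → Connected F
  trailColourConnected⇒connected tcc u v = decidable-stable (conn? F u v) impossible
    where
    impossible : ¬ ¬ Conn F u v
    impossible ¬c with cut ¬c | tcc {u} {v} (λ { refl → ¬c λ _ _ → refl })
    ... | K , clK , Ku , Kv | w , _
      with crossing-step {K} w (λ eq → case trans (sym Ku) (trans eq Kv) of λ ())
    ... | e , x , y , j , ne with contact {u = x} {y} (λ { (conn d) → ne (d K clK) }) (e , j , refl)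
    ...   | inj₁ (z , y~z , g) =
      not-trailColourConnected (#-moveˡ y~z (λ { (conn d) → ne (sym (d K clK)) })) g tcc
    ...   | inj₂ (z , x~z , g) =
      not-trailColourConnected (#-moveˡ x~z (λ { (conn d) → ne (d K clK) })) g tcc

-- Twins and M-closedness in an extension

module Extensions {G₀ G : Graph} (mc : Graph.MClosed G₀) (ext : Extension G₀ G) where
  open Extension ext
  open Graph
  open Trails using (joins-end; joins-sym)

  class : V G → V G₀
  class x = proj₁ (Inverse.from copies x)

  class-copy : ∀ i q → class (Inverse.to copies (i , q)) ≡ i
  class-copy i q = cong proj₁ (Inverse.strictlyInverseʳ copies (i , q))

  copy-of : ∀ {x i} → class x ≡ i → ∃[ q ] Inverse.to copies (i , q) ≡ x
  copy-of {x} refl = proj₂ (Inverse.from copies x) , Inverse.strictlyInverseˡ copies x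

  edge-below : ∀ {e x y} → Joins G e x y →
               ∃[ e₀ ] Joins G₀ e₀ (class x) (class y) × colour G e ≡ colour G₀ e₀
  edge-below {e} j with Inverse.from links e | Inverse.strictlyInverseˡ links e
  ... | e₀ , q , r | refl with joins-end G j (link-joins e₀ q r)
  ...   | inj₁ (refl , refl) = e₀ , inj₁ (sym (class-copy _ q) , sym (class-copy _ r)) , link-colour e₀ q r
  ...   | inj₂ (refl , refl) = e₀ , inj₂ (sym (class-copy _ q) , sym (class-copy _ r)) , link-colour e₀ q r

  edge-above : ∀ {e₀ x y} → Joins G₀ e₀ (class x) (class y) →
               ∃[ e ] Joins G e x y × colour G e ≡ colour G₀ e₀
  edge-above {e₀} {x} {y} (inj₁ (p , q)) with copy-of {x} (sym p) | copy-of {y} (sym q)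
  ... | a , refl | b , refl = _ , link-joins e₀ a b , link-colour e₀ a b
  edge-above {e₀} {x} {y} (inj₂ (p , q)) with copy-of {y} (sym p) | copy-of {x} (sym q)
  ... | a , refl | b , refl = _ , joins-sym G (link-joins e₀ a b) , link-colour e₀ a b

  twin : ∀ {e x y u} → class x ≡ class y → Joins G e x u → ∃[ f ] Joins G f y u × colour G f ≡ colour G e
  twin {u = u} eq j with edge-below j
  ... | e₀ , j₀ , c₀ with edge-above (subst (λ i → Joins G₀ e₀ i (class u)) eq j₀)
  ...   | f , jf , cf = f , jf , trans cf (sym c₀)

  mclosed : ∀ {u x z e f} → Joins G e u x → Joins G f u z → colour G e ≡ colour G f →
            class x ≢ class z → ∃[ g ] Joins G g x z
  mclosed je jf c n with edge-below je | edge-below jf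
  ... | e₀ , je₀ , ce | f₀ , jf₀ , cf with mc je₀ jf₀ (trans (sym ce) (trans c cf)) n
  ...   | g₀ , jg₀ with edge-above jg₀
  ...     | g , jg , _ = g , jg

  two-vertices : Σ[ x ∈ V G ] Σ[ y ∈ V G ] x ≢ y
  two-vertices = go (order G₀) refl
    where
    some-copy : V G₀ → V G
    some-copy i = Inverse.to copies (i , fromℕ< (p≥1 i))
    go : ∀ n → n ≡ order G₀ → Σ[ x ∈ V G ] Σ[ y ∈ V G ] x ≢ y
    go zero          eq = case subst (1 ℕ.<_) (sym eq) order>1 of λ ()
    go (suc zero)    eq = case subst (1 ℕ.<_) (sym eq) order>1 of λ { (ℕ.s≤s ()) }
    go (suc (suc n)) refl = some-copy zero , some-copy (suc zero) , λ eq →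
      case trans (sym (class-copy zero _)) (trans (cong class eq) (class-copy (suc zero) _)) of λ ()

-- The balanced edge set of an eulerian factor

module Factors {G : Graph} (factor : EulerianFactor G) where
  open EulerianFactor factor
  open InducedSubgraph
  open Graph G
  open Trails G
  open Circuits G

  circuit : ∀ i → ∃[ u ] ∃[ es ] Circuits.Circuit (part i) u es × Unique es × (∀ x → Trails.Incident (part i) x es)
  circuit i = Circuits.euler-circuit (part i) (supereulerian i)

  root : ∀ i → Graph.V (part i)
  root i = proj₁ (circuit i)

  trail : ∀ i → List E
  trail i = map (edge (induced i)) (proj₁ (proj₂ (circuit i)))

  edge-joins′ : ∀ i {e u v} → Graph.Joins (part i) e u v →
                Joins (edge (induced i) e) (vertex (induced i) u) (vertex (induced i) v)
  edge-joins′ i {e} (inj₁ (refl , refl)) = edge-joins (induced i) e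
  edge-joins′ i {e} (inj₂ (refl , refl)) = joins-sym (edge-joins (induced i) e)

  arc-image : ∀ i {u s es v t} → Trails.Arc (part i) u s es v t →
              Arc (vertex (induced i) u) s (map (edge (induced i)) es) (vertex (induced i) v) t
  arc-image i (Trails.single {e = e} j c)     = single (edge-joins′ i j) (trans (edge-colour (induced i) e) c)
  arc-image i (Trails.cons {e = e} j c n a)   = cons (edge-joins′ i j) (trans (edge-colour (induced i) e) c) n (arc-image i a)

  trail-circuit : ∀ i → Circuit (vertex (induced i) (root i)) (trail i)
  trail-circuit i = let _ , _ , (s , t , s≢t , a) , _ = circuit i in s , t , s≢t , arc-image i a

  trail-unique : ∀ i → Unique (trail i)
  trail-unique i = Unique.map⁺ (edge-injective (induced i)) (proj₁ (proj₂ (proj₂ (proj₂ (circuit i)))))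

  trail-incident : ∀ i u → Incident (vertex (induced i) u) (trail i)
  trail-incident i u = Any.map⁺ (Any.map (λ {e} → meets {e}) (proj₂ (proj₂ (proj₂ (proj₂ (circuit i)))) u))
    where
    meets : ∀ {e} → Trails.Meets (part i) u e → Meets (vertex (induced i) u) (edge (induced i) e)
    meets {e} (inj₁ refl) = joins-meets (edge-joins (induced i) e)
    meets {e} (inj₂ refl) = joins-meets (joins-sym (edge-joins (induced i) e))

  trail-disjoint : ∀ {i j e} → e ∈ trail i → e ∈ trail j → i ≡ j
  trail-disjoint {i} {j} p q with ∈-map⁻ (edge (induced i)) p | ∈-map⁻ (edge (induced j)) q
  ... | a , _ , refl | b , _ , eq
    with joins-end (edge-joins (induced i) a)
           (subst (λ e → Joins e (vertex (induced j) (Graph.src (part j) b)) (vertex (induced j) (Graph.tgt (part j) b)))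
                  (sym eq) (edge-joins (induced j) b))
  ...   | inj₁ (eq′ , _) = disjoint (sym eq′)
  ...   | inj₂ (eq′ , _) = disjoint (sym eq′)

  all-trails : List E
  all-trails = concat (tabulate trail)

  F : EdgeSet
  F = setAll true all-trails λ _ → false

  in-F : ∀ i → In F (trail i)
  in-F i = All.tabulate λ e∈ → setAll-∈ all-trails (∈-concat⁺′ e∈ (∈-tabulate⁺ i))

  balanced : Balanced F
  balanced S = trans
    (bal-setAll-true (ind S) (Unique.concat⁺ (All.tabulate⁺ trail-unique)
      (AllPairs.tabulate⁺ λ i≢j (p , q) → i≢j (trail-disjoint p q))) (All.tabulate λ _ → refl))
    (cong₂ _+_ (sum-replicate-zero size)
      (total-concat (ind S) (All.tabulate⁺ λ i → let _ , _ , s≢t , a = trail-circuit i in total-closed (ind S) a s≢t)))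

  to-root : ∀ x → ∃[ i ] Conn F x (vertex (induced i) (root i))
  to-root x with covering x
  ... | i , u , refl with trail-circuit i
  ...   | _ , _ , _ , a = i , λ S cl → sym (arc-conn a (in-F i) (trail-incident i u) S cl)

  nonIsolated : ∀ x → ∃[ y ] x ≢ y × Conn F x y
  nonIsolated x with covering x
  ... | i , u , eq with find (trail-incident i u)
  ...   | e , e∈ , m = other-end (All.lookup (in-F i) e∈) (subst (λ z → Meets z e) eq m)
    where
    other-end : ∀ {e} → F e ≡ true → Meets x e → ∃[ y ] x ≢ y × Conn F x y
    other-end {e} Fe (inj₁ refl) = tgt e , loopless e , edge-conn Fe (ends e)
    other-end {e} Fe (inj₂ refl) = src e , loopless e ∘ sym , edge-conn Fe (joins-sym (ends e))

-- Induction on the number of components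

module Main {G₀ G : Graph} (mc : Graph.MClosed G₀) (ext : Extension G₀ G)
            (tcc : Graph.TrailColourConnected G) where
  open Graph G
  open Trails G
  open Circuits G
  open Extensions mc ext

  merge : ∀ k (rep : Fin k → V) F → Balanced F → (∀ x → ∃[ y ] x ≢ y × Conn F x y) →
          (∀ x → ∃[ i ] Conn F x (rep i)) → ¬ ¬ Solution
  merge zero rep F _ _ cover _ = case cover (proj₁ two-vertices) of λ { (() , _) }
  merge (suc k) rep F balF nonIso cover none =
    none (F , balF , Unimprovable.trailColourConnected⇒connected G F balF nonIso unimprovable class twin mclosed (λ {u} {v} → tcc {u} {v}))
    where
    unimprovable : ¬ Improvements.Improvement G F balF
    unimprovable (F′ , balF′ , mono , e , ¬c , c) with cover (src e) | cover (tgt e)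
    ... | i , src~i | j , tgt~j = merge k (rep ∘ punchIn j) F′ balF′
        (λ x → let y , x≢y , d = nonIso x in y , x≢y , lift d) cover′ none
      where
      lift : ∀ {x y} → Conn F x y → Conn F′ x y
      lift = conn-mono {F} {F′} mono
      j≢i : j ≢ i
      j≢i refl = ¬c λ S cl → trans (src~i S cl) (sym (tgt~j S cl))
      i~j : Conn F′ (rep i) (rep j)
      i~j S cl = trans (sym (lift src~i S cl)) (trans (c S cl) (lift tgt~j S cl))
      cover′ : ∀ x → ∃[ l ] Conn F′ x (rep (punchIn j l))
      cover′ x with cover x
      ... | l , x~l with j ≟ l
      ...   | no j≢l   = punchOut j≢l , subst (λ z → Conn F′ x (rep z)) (sym (punchIn-punchOut j≢l)) (lift x~l)
      -- What `rep j` stood for now belongs to the component of `rep i`.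
      ...   | yes refl = punchOut j≢i , subst (λ z → Conn F′ x (rep z)) (sym (punchIn-punchOut j≢i))
                           λ S cl → trans (lift x~l S cl) (sym (i~j S cl))

  -- Since there are two vertices, a connected F has an edge, from which the first circuit is grown.
  solution⇒supereulerian : Solution → Supereulerian
  solution⇒supereulerian (F , balF , conF) with two-vertices | any? (λ e → F e ≟ᵇ true)
  ... | x , y , x≢y | no none =
    case trans (sym (dec-true (x ≟ x) refl))
           (trans (conF x y (λ v → does (x ≟ v)) λ e Fe → ⊥-elim (none (e , Fe))) (dec-false (x ≟ y) x≢y)) of λ ()
  ... | _ | yes (e , Fe)
    with close balF (suc size) (single (ends e) refl) ([] ∷ []) (Fe ∷ []) (ℕ.m≤m+n (suc size) 1)
  ... | q , fs , a , q≢t , u , Ffs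
    with spanning-circuit balF conF (suc size) (q , colour e , q≢t , a) u Ffs (ℕ.m≤m+n (suc size) _)
  ... | _ , _ , c , u′ , inc = spanning-trail c u′ inc

  factor⇒supereulerian : EulerianFactor G → Supereulerian
  factor⇒supereulerian factor = solution⇒supereulerian (decidable-stable solution?
    (merge k (λ i → InducedSubgraph.vertex (induced i) (root i)) F balanced nonIsolated to-root))
    where
    open EulerianFactor factor using (k; induced)
    open Factors factor

theorem28 : (G₀ G : Graph) → Graph.MClosed G₀ → Extension G₀ G →
    Graph.Supereulerian G ⇔ (Graph.TrailColourConnected G × EulerianFactor G)
theorem28 G₀ G mc ext = mk⇔ forward backward
  where
  forward : Graph.Supereulerian G → Graph.TrailColourConnected G × EulerianFactor G
  forward se = Circuits.supereulerian⇒trailColourConnected G se , supereulerian⇒factor se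
  backward : Graph.TrailColourConnected G × EulerianFactor G → Graph.Supereulerian G
  backward (tcc , factor) = Main.factor⇒supereulerian mc ext (λ {u} {v} → tcc {u} {v}) factor
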